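{- The permutations $312$ and $23514$ form an annihilator pair: for every permutation $\tau$ and every pair of distinct indices $i,j\le|\tau|$, the permutation $\tau_{i,j}[312,23514]$ satisfies $\mu[1,\tau_{i,j}[312,23514]]=0$.
   Context: Permutations are ordered by containment: $\sigma\le\pi$ if $\pi$ has a subsequence order-isomorphic to $\sigma$. The Möbius function: $\mu[\sigma,\pi]=0$ if $\sigma\not\le\pi$, $\mu[\sigma,\pi]=1$ if $\sigma=\pi$, and $\mu[\sigma,\pi]=-\sum_{\sigma\le\tau<\pi}\mu[\sigma,\tau]$ otherwise; $1$ is the permutation of length one. For a permutation $\tau$ of length $m$, distinct indices $i,j\le m$ and non-empty permutations $\phi,\psi$, the inflation $\tau_{i,j}[\phi,\psi]$ is the permutation obtained from $\tau$ by replacing the entry $\tau_i$ by a block of $|\phi|$ consecutive positions whose values form a set of consecutive integers and are order-isomorphic to $\phi$, replacing $\tau_j$ likewise by a block order-isomorphic to $\psi$, and keeping every other entry as a single entry, so that the relative order between different blocks/entries is that of the corresponding entries of $\tau$. -}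

module Defs where

open import Data.Nat as ℕ using (ℕ; zero; suc; _<?_)
open import Data.Integer as ℤ using (ℤ; +_; -_)
open import Data.List using (List; []; _∷_; _++_; map; filter; length; lookup; concatMap; deduplicate; upTo)
import Data.List.Properties as LP
open import Data.List.Membership.Propositional using (_∈_)
open import Data.List.Relation.Binary.Permutation.Propositional using (_↭_)
open import Data.List.Membership.DecPropositional (LP.≡-dec ℕ._≟_) using (_∈?_)
open import Data.Fin using (Fin; _≟_)
open import Data.Fin.Properties using ()
open import Relation.Nullary using (Dec; yes; no; ¬?)
open import Relation.Binary.PropositionalEquality using (_≡_)
open import Data.Bool using (if_then_else_)
open import Data.Nat.ListAction using (sum)
open import Relation.Nullary.Decidable using (⌊_⌋)

-- Permutations are lists of naturals; a permutation of length n is a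
-- rearrangement of 0,1,…,n-1 (0-based values).
IsPerm : List ℕ → Set
IsPerm π = π ↭ upTo (length π)

_≟L_ : (xs ys : List ℕ) → Dec (xs ≡ ys)
_≟L_ = LP.≡-dec ℕ._≟_

subseqs : List ℕ → List (List ℕ)
subseqs [] = [] ∷ []
subseqs (x ∷ xs) = map (x ∷_) (subseqs xs) ++ subseqs xs

-- standardisation: the permutation order-isomorphic to a list of distinct values
st : List ℕ → List ℕ
st xs = map (λ x → length (filter (_<? x) xs)) xs

patterns : List ℕ → List (List ℕ)
patterns π = deduplicate _≟L_ (map st (subseqs π))

_≼_ : List ℕ → List ℕ → Set
σ ≼ π = σ ∈ patterns π

_≼?_ : (σ π : List ℕ) → Dec (σ ≼ π)
σ ≼? π = σ ∈? patterns π

properPatterns : List ℕ → List (List ℕ)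
properPatterns π = filter (λ τ → ¬? (τ ≟L π)) (patterns π)

-- Möbius function, by recursion with fuel (= length of π suffices,
-- since proper patterns of π are strictly shorter than π)
mob : ℕ → List ℕ → List ℕ → ℤ
mob zero σ π = if ⌊ σ ≟L π ⌋ then + 1 else + 0
mob (suc n) σ π =
  if ⌊ σ ≟L π ⌋ then + 1
  else if ⌊ σ ≼? π ⌋
       then - ℤsum (map (mob n σ) (filter (σ ≼?_) (properPatterns π)))
       else + 0
  where
  ℤsum : List ℤ → ℤ
  ℤsum [] = + 0
  ℤsum (z ∷ zs) = z ℤ.+ ℤsum zs

μ : List ℕ → List ℕ → ℤ
μ σ π = mob (length π) σ π

one : List ℕ
one = 0 ∷ []

p312 : List ℕ
p312 = 2 ∷ 0 ∷ 1 ∷ []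

p23514 : List ℕ
p23514 = 1 ∷ 2 ∷ 4 ∷ 0 ∷ 3 ∷ []

-- inflation τ_{i,j}[φ,ψ] (i ≠ j): position i becomes a block ≅ φ,
-- position j a block ≅ ψ, every other position a single entry.
module _ (τ : List ℕ) (i j : Fin (length τ)) (φ ψ : List ℕ) where
  block : Fin (length τ) → List ℕ
  block k with k ≟ i | k ≟ j
  ... | yes _ | _     = φ
  ... | no _  | yes _ = ψ
  ... | no _  | no _  = 0 ∷ []

  positions : List (Fin (length τ))
  positions = Data.List.allFin (length τ)
    where import Data.List

  offset : Fin (length τ) → ℕ
  offset k = sum (map (λ l → length (block l))
                  (filter (λ l → lookup τ l <? lookup τ k) positions))

  inflate₂ : List ℕ
  inflate₂ = concatMap (λ k → map (offset k ℕ.+_) (block k)) positions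

{-# OPTIONS --safe #-}

-- Write f σ = μ[1,σ]. Then f sums to zero over the patterns of any word with at least two
-- letters, so f π = 0 follows from words u₁, …, uₙ contained in π and integers cᵢ such that
-- Σ cᵢ [σ ≤ uᵢ] = [σ = π] for every pattern σ of π with f σ ≠ 0. For a word w with disjoint
-- intervals φ and ψ, take for the uᵢ the words got by shrinking the two blocks, weighted by
-- (φ − φ₁ − φ₂ + φ₀) ⊗ (ψ − ψ′), where φ₁ and φ₂ cover the proper patterns of φ and meet in φ₀.
-- An occurrence of σ using exactly α in the first block and β in the second gives σ intervals
-- α and β, so every σ violating the identity contains a pair of intervals already known to
-- force f σ = 0, or the pair φ, ψ itself, in which case induction on the length applies.
-- This is run for the pairs
--   (12; 21 − 1),  (312; 123 − 12),  (312; 2314 − 231),  (312; 23514 − 2413)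
-- with 12 − 1 for φ = 12 and 312 − 12 − 21 + 1 for φ = 312.
module Submission where

open import Defs
open import Data.Bool using (if_then_else_)
open import Data.Fin as Fin using (Fin)
open import Data.Integer as ℤ using (ℤ; +_; -_; 0ℤ; 1ℤ; -1ℤ)
import Data.Integer.Properties as ℤₚ
open import Data.List as List
  using (List; []; _∷_; _++_; map; filter; foldr; concatMap; length; take; drop)
import Data.List.Properties as Listₚ
open import Data.List.Membership.Propositional using (_∈_; find)
open import Data.List.Membership.Propositional.Properties
  using (∈-++⁺ˡ; ∈-++⁺ʳ; ∈-++⁻; ∈-map⁺; ∈-map⁻; ∈-deduplicate⁺; ∈-deduplicate⁻;
         ∈-filter⁺; ∈-filter⁻; ∈-∃++; ∈-allFin; ∈-lookup; ∈-concatMap⁻)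
open import Data.List.Membership.Propositional.Properties.WithK using (unique∧set⇒bag)
open import Data.List.Relation.Binary.BagAndSetEquality using (∼bag⇒↭)
open import Data.List.Relation.Binary.Permutation.Propositional as ↭ using (_↭_; ↭-sym; ↭⇒↭ₛ)
open import Data.List.Relation.Binary.Sublist.Propositional
  using (_⊆_; []; _∷_; _∷ʳ_; ⊆-refl; ⊆-trans; minimum; lookup)
import Data.List.Relation.Binary.Sublist.Propositional.Properties as Subₚ
open import Data.List.Relation.Unary.All as All using (All; []; _∷_)
import Data.List.Relation.Unary.All.Properties as Allₚ
open import Data.List.Relation.Unary.AllPairs using ([]; _∷_)
open import Data.List.Relation.Unary.Any using (here; there)
open import Data.List.Relation.Unary.Unique.Propositional using (Unique)
import Data.List.Relation.Unary.Unique.Propositional.Properties as Uniqueₚ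
import Data.List.Relation.Unary.Unique.DecPropositional.Properties _≟L_ as UniqueDec
open import Data.Maybe as Maybe using (Maybe; just; nothing; _<∣>_; from-just)
open import Data.Nat as ℕ using (ℕ; zero; suc; _<_; _≤_; _<?_; _≡ᵇ_; z≤n; s≤s)
open import Data.Nat.Induction using (<-rec)
open import Data.Nat.ListAction using (sum)
import Data.Nat.Properties as ℕₚ
open import Data.Product using (∃; ∃₂; _×_; _,_; proj₁; proj₂)
open import Data.Sum using (_⊎_; inj₁; inj₂)
open import Function using (_∘_; id; mk⇔)
open import Relation.Binary.Definitions using (tri<; tri≈; tri>)
open import Relation.Binary.PropositionalEquality
open import Relation.Nullary using (Dec; yes; no; ¬_; ¬?; contradiction)
open import Relation.Nullary.Decidable using (True; toWitness; _⊎-dec_; _→-dec_)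
open import Relation.Unary using (Pred; Decidable)
open import Data.List.Relation.Binary.Permutation.Setoid.Properties (setoid ℕ) using (Unique-resp-↭)

-- Order isomorphism and standardisation

Word : Set
Word = List ℕ

count : ℕ → Word → ℕ
count x ws = length (filter (_<? x) ws)

count-< : ∀ {x z ws} → z < x → count x (z ∷ ws) ≡ suc (count x ws)
count-< {x} z<x = cong length (Listₚ.filter-accept (_<? x) z<x)

count-≮ : ∀ {x z ws} → ¬ z < x → count x (z ∷ ws) ≡ count x ws
count-≮ {x} z≮x = cong length (Listₚ.filter-reject (_<? x) z≮x)

count-mono : ∀ {x y} ws → x ≤ y → count x ws ≤ count y ws
count-mono [] x≤y = z≤n
count-mono {x} {y} (z ∷ ws) x≤y with z <? x
... | yes z<x rewrite count-< {ws = ws} z<x | count-< {ws = ws} (ℕₚ.<-≤-trans z<x x≤y) =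
  s≤s (count-mono ws x≤y)
... | no z≮x rewrite count-≮ {ws = ws} z≮x with z <? y
... | yes z<y rewrite count-< {ws = ws} z<y = ℕₚ.m≤n⇒m≤1+n (count-mono ws x≤y)
... | no z≮y rewrite count-≮ {ws = ws} z≮y = count-mono ws x≤y

-- The letter `x` itself is counted below `y` but not below `x`; this makes the inequality strict.
count-mono-< : ∀ {x y ws} → x ∈ ws → x < y → count x ws < count y ws
count-mono-< {x} {y} {_ ∷ ws} (here refl) x<y
  rewrite count-≮ {ws = ws} (ℕₚ.n≮n x) | count-< {ws = ws} x<y = s≤s (count-mono ws (ℕₚ.<⇒≤ x<y))
count-mono-< {x} {y} {z ∷ ws} (there x∈) x<y with z <? x
... | yes z<x rewrite count-< {ws = ws} z<x | count-< {ws = ws} (ℕₚ.<-trans z<x x<y) =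
  s≤s (count-mono-< x∈ x<y)
... | no z≮x rewrite count-≮ {ws = ws} z≮x with z <? y
... | yes z<y rewrite count-< {ws = ws} z<y = ℕₚ.m≤n⇒m≤1+n (count-mono-< x∈ x<y)
... | no z≮y rewrite count-≮ {ws = ws} z≮y = count-mono-< x∈ x<y

-- Two words of equal length are kept as one list of pairs, so that corresponding letters stay
-- together without indices.
OrderIso : List (ℕ × ℕ) → Set
OrderIso zs = ∀ {a b} → a ∈ zs → b ∈ zs →
  (proj₁ a < proj₁ b → proj₂ a < proj₂ b) × (proj₂ a < proj₂ b → proj₁ a < proj₁ b)

count-iso : ∀ {x y} (zs : List (ℕ × ℕ)) →
  (∀ {b} → b ∈ zs → (proj₁ b < x → proj₂ b < y) × (proj₂ b < y → proj₁ b < x)) →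
  count x (map proj₁ zs) ≡ count y (map proj₂ zs)
count-iso [] H = refl
count-iso {x} {y} ((a , b) ∷ zs) H with a <? x
... | yes a<x rewrite count-< {ws = map proj₁ zs} a<x
                    | count-< {ws = map proj₂ zs} (proj₁ (H (here refl)) a<x) =
  cong suc (count-iso zs (λ i → H (there i)))
... | no a≮x rewrite count-≮ {ws = map proj₁ zs} a≮x
                   | count-≮ {ws = map proj₂ zs} (λ b<y → a≮x (proj₂ (H (here refl)) b<y)) =
  count-iso zs (λ i → H (there i))

iso⇒st : ∀ zs → OrderIso zs → st (map proj₁ zs) ≡ st (map proj₂ zs)
iso⇒st zs iso = begin
  map (λ x → count x (map proj₁ zs)) (map proj₁ zs) ≡⟨ Listₚ.map-∘ zs ⟨
  map (λ z → count (proj₁ z) (map proj₁ zs)) zs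
    ≡⟨ Listₚ.map-cong-local (All.tabulate λ z∈ → count-iso zs (λ b∈ → iso b∈ z∈)) ⟩
  map (λ z → count (proj₂ z) (map proj₂ zs)) zs     ≡⟨ Listₚ.map-∘ zs ⟩
  map (λ x → count x (map proj₂ zs)) (map proj₂ zs) ∎
  where open ≡-Reasoning

align : ∀ (f g : ℕ → ℕ) us vs → map f us ≡ map g vs →
  ∃ λ zs → us ≡ map proj₁ zs × vs ≡ map proj₂ zs × (∀ {z} → z ∈ zs → f (proj₁ z) ≡ g (proj₂ z))
align f g [] [] e = [] , refl , refl , λ ()
align f g (u ∷ us) (v ∷ vs) e with Listₚ.∷-injective e
... | e₁ , e₂ with align f g us vs e₂
... | zs , refl , refl , H = (u , v) ∷ zs , refl , refl ,
  λ { (here refl) → e₁ ; (there i) → H i }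

-- Ranks increase strictly on the letters of a word and weakly everywhere, so equal ranks at
-- corresponding places force equal comparisons of the letters.
st⇒iso : ∀ {us vs} → st us ≡ st vs → ∃ λ zs → us ≡ map proj₁ zs × vs ≡ map proj₂ zs × OrderIso zs
st⇒iso {us} {vs} e with align (λ x → count x us) (λ x → count x vs) us vs e
... | zs , refl , refl , H = zs , refl , refl , iso
  where
  iso : OrderIso zs
  proj₁ (iso {a} {b} a∈ b∈) a<b = ℕₚ.≰⇒> λ b≤a → ℕₚ.<⇒≱
    (subst₂ _<_ (H a∈) (H b∈) (count-mono-< (∈-map⁺ proj₁ a∈) a<b)) (count-mono (map proj₂ zs) b≤a)
  proj₂ (iso {a} {b} a∈ b∈) a<b = ℕₚ.≰⇒> λ b≤a → ℕₚ.<⇒≱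
    (subst₂ _<_ (sym (H a∈)) (sym (H b∈)) (count-mono-< (∈-map⁺ proj₂ a∈) a<b)) (count-mono (map proj₁ zs) b≤a)

-- Monotonicity is asked only on the letters of one word: beyond them the rank map is in general not
-- strictly increasing.
MonoOn : (ℕ → ℕ) → Word → Set
MonoOn h xs = ∀ {x y} → x ∈ xs → y ∈ xs → x < y → h x < h y

MonoOn-reflects : ∀ {h xs} → MonoOn h xs → ∀ {x y} → x ∈ xs → y ∈ xs → h x < h y → x < y
MonoOn-reflects {h} m {x} {y} x∈ y∈ hx<hy with ℕₚ.<-cmp x y
... | tri< x<y _ _  = x<y
... | tri≈ _ refl _ = contradiction hx<hy (ℕₚ.<-irrefl refl)
... | tri> _ _ y<x  = contradiction (m y∈ x∈ y<x) (ℕₚ.<-asym hx<hy)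

MonoOn-⊆ : ∀ {h xs ys} → xs ⊆ ys → MonoOn h ys → MonoOn h xs
MonoOn-⊆ xs⊆ys m x∈ y∈ = m (lookup xs⊆ys x∈) (lookup xs⊆ys y∈)

st-map : ∀ {h xs} → MonoOn h xs → st (map h xs) ≡ st xs
st-map {h} {xs} m = begin
  st (map h xs)                              ≡⟨ cong st (Listₚ.map-∘ xs) ⟩
  st (map proj₁ (map (λ x → h x , x) xs))    ≡⟨ iso⇒st (map (λ x → h x , x) xs) iso ⟩
  st (map proj₂ (map (λ x → h x , x) xs))    ≡⟨ cong st (Listₚ.map-∘ xs) ⟨
  st (map (λ x → x) xs)                      ≡⟨ cong st (Listₚ.map-id xs) ⟩
  st xs                                      ∎
  where
  open ≡-Reasoning
  iso : OrderIso (map (λ x → h x , x) xs)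
  iso a∈ b∈ with ∈-map⁻ (λ x → h x , x) a∈ | ∈-map⁻ (λ x → h x , x) b∈
  ... | x , x∈ , refl | y , y∈ , refl = MonoOn-reflects m x∈ y∈ , m x∈ y∈

rank-mono : ∀ ws → MonoOn (λ x → count x ws) ws
rank-mono ws x∈ _ x<y = count-mono-< x∈ x<y

st-idem : ∀ ws → st (st ws) ≡ st ws
st-idem ws = st-map (rank-mono ws)

-- Subwords and pattern containment

⊆-map⁻ : ∀ (h : ℕ → ℕ) {us} xs → us ⊆ map h xs → ∃ λ ys → us ≡ map h ys × ys ⊆ xs
⊆-map⁻ h [] [] = [] , refl , []
⊆-map⁻ h (x ∷ xs) (_ ∷ʳ s) with ⊆-map⁻ h xs s
... | ys , refl , s′ = ys , refl , x ∷ʳ s′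
⊆-map⁻ h (x ∷ xs) (refl ∷ s) with ⊆-map⁻ h xs s
... | ys , refl , s′ = x ∷ ys , refl , refl ∷ s′

⊆-++⁻ : ∀ {us : Word} xs ys → us ⊆ xs ++ ys →
  ∃₂ λ us₁ us₂ → us ≡ us₁ ++ us₂ × us₁ ⊆ xs × us₂ ⊆ ys
⊆-++⁻ [] ys s = [] , _ , refl , [] , s
⊆-++⁻ (x ∷ xs) ys (_ ∷ʳ s) with ⊆-++⁻ xs ys s
... | us₁ , us₂ , refl , s₁ , s₂ = us₁ , us₂ , refl , x ∷ʳ s₁ , s₂
⊆-++⁻ (x ∷ xs) ys (refl ∷ s) with ⊆-++⁻ xs ys s
... | us₁ , us₂ , refl , s₁ , s₂ = x ∷ us₁ , us₂ , refl , refl ∷ s₁ , s₂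

⊆⇒∈subseqs : ∀ {us ws} → us ⊆ ws → us ∈ subseqs ws
⊆⇒∈subseqs [] = here refl
⊆⇒∈subseqs {ws = w ∷ ws} (_ ∷ʳ s) = ∈-++⁺ʳ (map (w ∷_) (subseqs ws)) (⊆⇒∈subseqs s)
⊆⇒∈subseqs {ws = w ∷ ws} (refl ∷ s) = ∈-++⁺ˡ (∈-map⁺ (w ∷_) (⊆⇒∈subseqs s))

∈subseqs⇒⊆ : ∀ {us} ws → us ∈ subseqs ws → us ⊆ ws
∈subseqs⇒⊆ [] (here refl) = []
∈subseqs⇒⊆ (w ∷ ws) i with ∈-++⁻ (map (w ∷_) (subseqs ws)) i
... | inj₂ j = w ∷ʳ ∈subseqs⇒⊆ ws j
... | inj₁ j with ∈-map⁻ (w ∷_) j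
... | us , k , refl = refl ∷ ∈subseqs⇒⊆ ws k

⊆⇒≼ : ∀ {us ws} → us ⊆ ws → st us ≼ ws
⊆⇒≼ s = ∈-deduplicate⁺ _≟L_ (∈-map⁺ st (⊆⇒∈subseqs s))

≼⇒⊆ : ∀ {σ} ws → σ ≼ ws → ∃ λ us → us ⊆ ws × σ ≡ st us
≼⇒⊆ ws i with ∈-map⁻ st (∈-deduplicate⁻ _≟L_ (map st (subseqs ws)) i)
... | us , us∈ , e = us , ∈subseqs⇒⊆ ws us∈ , e

≼-mono : ∀ {σ us ws} → us ⊆ ws → σ ≼ us → σ ≼ ws
≼-mono {us = us} s i with ≼⇒⊆ us i
... | vs , t , refl = ⊆⇒≼ (⊆-trans t s)

≼⇒st : ∀ {σ} ws → σ ≼ ws → st σ ≡ σ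
≼⇒st ws i with ≼⇒⊆ ws i
... | us , _ , refl = st-idem us

length-st : ∀ ws → length (st ws) ≡ length ws
length-st ws = Listₚ.length-map _ ws

⊆-full : ∀ {us ws : Word} → us ⊆ ws → length ws ≤ length us → us ≡ ws
⊆-full [] _ = refl
⊆-full (_ ∷ʳ s) l = contradiction l (ℕₚ.<⇒≱ (s≤s (Subₚ.length-mono-≤ s)))
⊆-full (refl ∷ s) (s≤s l) = cong (_ ∷_) (⊆-full s l)

≼-length : ∀ {σ} ws → σ ≼ ws → length σ ≤ length ws
≼-length ws i with ≼⇒⊆ ws i
... | us , s , refl = subst (_≤ length ws) (sym (length-st us)) (Subₚ.length-mono-≤ s)

≼-length-< : ∀ {σ} ws → σ ≼ ws → σ ≢ st ws → length σ < length ws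
≼-length-< ws i ne with ≼⇒⊆ ws i
... | us , s , refl = subst (_< length ws) (sym (length-st us))
  (ℕₚ.≰⇒> λ l → ne (cong st (⊆-full s l)))

-- The rank map preserves the order of the letters of `ws`, so a subword and its image under it have
-- the same standardisation.
≼-st⁺ : ∀ {σ} ws → σ ≼ ws → σ ≼ st ws
≼-st⁺ ws i with ≼⇒⊆ ws i
... | us , s , refl = subst (_≼ st ws) (st-map (MonoOn-⊆ s (rank-mono ws))) (⊆⇒≼ (Subₚ.map⁺ _ s))

≼-st⁻ : ∀ {σ} ws → σ ≼ st ws → σ ≼ ws
≼-st⁻ ws i with ≼⇒⊆ (st ws) i
... | us , s , refl with ⊆-map⁻ (λ x → count x ws) ws s
... | vs , refl , t = subst (_≼ ws) (sym (st-map (MonoOn-⊆ t (rank-mono ws)))) (⊆⇒≼ t)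

-- Summing the Möbius function over patterns

f : Word → ℤ
f = μ one

∑ : (Word → ℤ) → List Word → ℤ
∑ g ws = foldr ℤ._+_ 0ℤ (map g ws)

∑-cong : ∀ {g h} ws → (∀ {w} → w ∈ ws → g w ≡ h w) → ∑ g ws ≡ ∑ h ws
∑-cong []       e = refl
∑-cong (w ∷ ws) e = cong₂ ℤ._+_ (e (here refl)) (∑-cong ws (e ∘ there))

∑-zero : ∀ ws → ∑ (λ _ → 0ℤ) ws ≡ 0ℤ
∑-zero []       = refl
∑-zero (w ∷ ws) = trans (ℤₚ.+-identityˡ _) (∑-zero ws)

∑-+ : ∀ g h ws → ∑ (λ w → g w ℤ.+ h w) ws ≡ ∑ g ws ℤ.+ ∑ h ws
∑-+ g h []       = refl
∑-+ g h (w ∷ ws) rewrite ∑-+ g h ws = interchange (g w) (h w) (∑ g ws) (∑ h ws)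
  where open import Algebra.Properties.CommutativeSemigroup ℤₚ.+-commutativeSemigroup using (interchange)

∑-*ˡ : ∀ c g ws → ∑ (λ w → c ℤ.* g w) ws ≡ c ℤ.* ∑ g ws
∑-*ˡ c g []       = sym (ℤₚ.*-zeroʳ c)
∑-*ˡ c g (w ∷ ws) rewrite ∑-*ˡ c g ws = sym (ℤₚ.*-distribˡ-+ c (g w) (∑ g ws))

∑-↭ : ∀ g {us vs} → us ↭ vs → ∑ g us ≡ ∑ g vs
∑-↭ g ↭.refl = refl
∑-↭ g (↭.prep w p) = cong (λ z → g w ℤ.+ z) (∑-↭ g p)
∑-↭ g (↭.swap {xs} {ys} u v p) rewrite ∑-↭ g p = x∙yz≈y∙xz (g u) (g v) (∑ g ys)
  where open import Algebra.Properties.CommutativeSemigroup ℤₚ.+-commutativeSemigroup using (x∙yz≈y∙xz)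
∑-↭ g (↭.trans p q) = trans (∑-↭ g p) (∑-↭ g q)

∑-same : ∀ g {us vs} → Unique us → Unique vs →
  (∀ {w} → w ∈ us → w ∈ vs) → (∀ {w} → w ∈ vs → w ∈ us) → ∑ g us ≡ ∑ g vs
∑-same g u v i j = ∑-↭ g (∼bag⇒↭ (unique∧set⇒bag u v (mk⇔ i j)))

ind : ∀ {p} {P : Set p} → Dec P → ℤ
ind (yes _) = 1ℤ
ind (no _)  = 0ℤ

∑-filter : ∀ g {p} {P : Pred Word p} (P? : Decidable P) ws →
  ∑ g (filter P? ws) ≡ ∑ (λ w → g w ℤ.* ind (P? w)) ws
∑-filter g P? [] = refl
∑-filter g P? (w ∷ ws) with P? w
... | yes p =
  cong₂ ℤ._+_ (sym (ℤₚ.*-identityʳ (g w))) (∑-filter g P? ws)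
... | no ¬p rewrite ℤₚ.*-zeroʳ (g w) =
  trans (∑-filter g P? ws) (sym (ℤₚ.+-identityˡ _))

patterns-unique : ∀ ws → Unique (patterns ws)
patterns-unique ws = UniqueDec.deduplicate-! (map st (subseqs ws))

∑-one : ∀ g {ws w} → Unique ws → w ∈ ws → ∑ (λ v → g v ℤ.* ind (v ≟L w)) ws ≡ g w
∑-one g {ws} {w} u i = begin
  ∑ (λ v → g v ℤ.* ind (v ≟L w)) ws ≡⟨ ∑-filter g (_≟L w) ws ⟨
  ∑ g (filter (_≟L w) ws) ≡⟨ ∑-same g (Uniqueₚ.filter⁺ (_≟L w) u) ([] ∷ [])
     (λ j → here (proj₂ (∈-filter⁻ (_≟L w) {xs = ws} j))) (λ { (here refl) → ∈-filter⁺ (_≟L w) i refl }) ⟩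
  g w ℤ.+ 0ℤ ≡⟨ ℤₚ.+-identityʳ (g w) ⟩
  g w ∎
  where open ≡-Reasoning

-- This lets sums over the patterns of different subwords of `ws` be compared inside the single
-- index set `patterns ws`.
∑-patterns-mono : ∀ g {us ws} → us ⊆ ws →
  ∑ (λ σ → g σ ℤ.* ind (σ ≼? us)) (patterns ws) ≡ ∑ g (patterns us)
∑-patterns-mono g {us} {ws} s = begin
  ∑ (λ σ → g σ ℤ.* ind (σ ≼? us)) (patterns ws) ≡⟨ ∑-filter g (_≼? us) (patterns ws) ⟨
  ∑ g (filter (_≼? us) (patterns ws))
    ≡⟨ ∑-same g (Uniqueₚ.filter⁺ (_≼? us) (patterns-unique ws)) (patterns-unique us)
       (λ i → proj₂ (∈-filter⁻ (_≼? us) {xs = patterns ws} i)) (λ i → ∈-filter⁺ (_≼? us) (≼-mono s i) i) ⟩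
  ∑ g (patterns us) ∎
  where open ≡-Reasoning

-- The Möbius recursion and its independence of fuel

below : Word → List Word
below π = filter (one ≼?_) (properPatterns π)

mob-one : ∀ n → mob n one one ≡ 1ℤ
mob-one zero    = refl
mob-one (suc n) = refl

-- The summation local to mob has no name in scope: the left side of ℤsum-foldr
-- is inferred from its use in mob-≼.
mutual
  ℤsum-foldr : ∀ n π zs → _ ≡ foldr ℤ._+_ 0ℤ zs

  mob-≼ : ∀ n {π} → one ≢ π → one ≼ π → mob (suc n) one π ≡ - ∑ (mob n one) (below π)
  mob-≼ n {π} ne i with one ≟L π
  ... | yes e = contradiction e ne
  ... | no _ with one ≼? π
  ... | no ¬i = contradiction i ¬i
  -- Generalising the list of values to a variable fixes the left side of `ℤsum-foldr` as a function
  -- of an arbitrary list, on which it can recurse.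
  ... | yes _ with map (mob n one) (below π)
  ... | zs = cong -_ (ℤsum-foldr n π zs)

  ℤsum-foldr n π []       = refl
  ℤsum-foldr n π (z ∷ zs) = cong (λ y → z ℤ.+ y) (ℤsum-foldr n π zs)

mob-⋠ : ∀ n {π} → ¬ one ≼ π → mob n one π ≡ 0ℤ
mob-⋠ zero {π} ¬i with one ≟L π
... | yes refl = contradiction (here refl) ¬i
... | no _ = refl
mob-⋠ (suc n) {π} ¬i with one ≟L π
... | yes refl = contradiction (here refl) ¬i
... | no _ with one ≼? π
... | yes i = contradiction i ¬i
... | no _ = refl

proper-st : ∀ {σ} π → σ ∈ properPatterns π → st π ≡ π → σ ≼ π × length σ < length π
proper-st π i e with ∈-filter⁻ (λ τ → ¬? (τ ≟L π)) {xs = patterns π} i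
... | j , ne = j , ≼-length-< π j (subst (_ ≢_) (sym e) ne)

below⊆proper : ∀ {σ} π → σ ∈ below π → σ ∈ properPatterns π
below⊆proper π i = proj₁ (∈-filter⁻ (one ≼?_) {xs = properPatterns π} i)

st-short : ∀ π → st π ≡ π → length π ≤ 1 → π ≡ [] ⊎ π ≡ one
st-short []      e l = inj₁ refl
st-short (x ∷ []) e l = inj₂ (trans (sym e) (cong (_∷ []) (count-≮ {x} {x} {[]} (ℕₚ.n≮n x))))
st-short (x ∷ y ∷ π) e (s≤s ())

-- Proper patterns of a standardised word are shorter, so fuel and length decrease together. The
-- bound is `suc n` because fuel zero already gives the right values at `[]` and at `one`.
mob-fuel : ∀ n m π → st π ≡ π → length π ≤ suc n → length π ≤ suc m → mob n one π ≡ mob m one π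
mob-fuel zero m π e l _ with st-short π e l
... | inj₁ refl = trans (mob-⋠ zero {[]} ¬i) (sym (mob-⋠ m {[]} ¬i))
  where
  ¬i : ¬ one ≼ []
  ¬i (here ())
... | inj₂ refl = trans (mob-one zero) (sym (mob-one m))
mob-fuel (suc n) zero π e l k = sym (mob-fuel zero (suc n) π e k l)
mob-fuel (suc n) (suc m) π e l k = go (one ≟L π) (one ≼? π)
  where
  open ≡-Reasoning
  step : ∀ {σ} → σ ∈ below π → mob n one σ ≡ mob m one σ
  step {σ} j with proper-st π (below⊆proper π j) e
  ... | σ≼π , l′ = mob-fuel n m σ (≼⇒st π σ≼π)
    (ℕₚ.≤-pred (ℕₚ.≤-trans l′ l)) (ℕₚ.≤-pred (ℕₚ.≤-trans l′ k))
  go : Dec (one ≡ π) → Dec (one ≼ π) → mob (suc n) one π ≡ mob (suc m) one π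
  go (yes refl) _     = refl
  go (no _) (no ¬i)   = trans (mob-⋠ (suc n) {π} ¬i) (sym (mob-⋠ (suc m) {π} ¬i))
  go (no ne) (yes i)  = begin
    mob (suc n) one π          ≡⟨ mob-≼ n {π} ne i ⟩
    - ∑ (mob n one) (below π)  ≡⟨ cong -_ (∑-cong (below π) step) ⟩
    - ∑ (mob m one) (below π)  ≡⟨ mob-≼ m {π} ne i ⟨
    mob (suc m) one π          ∎

f-⋠ : ∀ {π} → ¬ one ≼ π → f π ≡ 0ℤ
f-⋠ {π} = mob-⋠ (length π)

-- The filter removes only patterns that do not contain `one`, and `f` is zero on those.
∑-below : ∀ π → ∑ f (below π) ≡ ∑ f (properPatterns π)
∑-below π = trans (∑-filter f (one ≼?_) (properPatterns π)) (∑-cong (properPatterns π) λ {σ} _ → step σ)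
  where
  step : ∀ σ → f σ ℤ.* ind (one ≼? σ) ≡ f σ
  step σ with one ≼? σ
  ... | yes _ = ℤₚ.*-identityʳ (f σ)
  ... | no ¬i = trans (ℤₚ.*-zeroʳ (f σ)) (sym (f-⋠ {σ} ¬i))

one-≼ : ∀ {π} → 0 < length π → one ≼ π
one-≼ {x ∷ π} _ = subst (_≼ (x ∷ π)) (cong (_∷ []) (count-≮ {x} {x} {[]} (ℕₚ.n≮n x)))
  (⊆⇒≼ {x ∷ []} (refl ∷ minimum π))

-- π itself need not be a permutation, so only its proper patterns are standardised.
f-recursion : ∀ π → 1 < length π → f π ≡ - ∑ f (properPatterns π)
f-recursion π l with length π in e
... | suc n = begin
  mob (suc n) one π                ≡⟨ mob-≼ n {π} ne (one-≼ {π} (subst (0 <_) (sym e) (s≤s z≤n))) ⟩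
  - ∑ (mob n one) (below π)        ≡⟨ cong -_ (∑-cong (below π) step) ⟩
  - ∑ f (below π)                  ≡⟨ cong -_ (∑-below π) ⟩
  - ∑ f (properPatterns π)         ∎
  where
  open ≡-Reasoning
  ne : one ≢ π
  ne refl = ℕₚ.n≮n 1 (subst (1 <_) (sym e) l)
  step : ∀ {σ} → σ ∈ below π → mob n one σ ≡ f σ
  step {σ} j with proj₁ (∈-filter⁻ (λ τ → ¬? (τ ≟L π)) {xs = patterns π} (below⊆proper π j))
  ... | σ≼π = mob-fuel n (length σ) σ (≼⇒st π σ≼π) (subst (length σ ≤_) e (≼-length π σ≼π)) (ℕₚ.n≤1+n _)

∑-properPatterns : ∀ {π} → st π ≡ π → f π ℤ.+ ∑ f (properPatterns π) ≡ ∑ f (patterns π)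
∑-properPatterns {π} e = ∑-same f (All.tabulate (λ j q → proj₂ (∈-filter⁻ ≢π? {xs = patterns π} j) (sym q))
    ∷ Uniqueₚ.filter⁺ ≢π? (patterns-unique π)) (patterns-unique π) to from
  where
  ≢π? : ∀ τ → Dec (τ ≢ π)
  ≢π? τ = ¬? (τ ≟L π)
  to : ∀ {w} → w ∈ π ∷ properPatterns π → w ∈ patterns π
  to (here refl) = subst (_≼ π) e (⊆⇒≼ ⊆-refl)
  to (there j)   = proj₁ (∈-filter⁻ ≢π? {xs = patterns π} j)
  from : ∀ {w} → w ∈ patterns π → w ∈ π ∷ properPatterns π
  from {w} j with w ≟L π
  ... | yes q = here q
  ... | no ¬q = there (∈-filter⁺ ≢π? j ¬q)

-- This is the defining recursion with all terms on one side, transported from `st w` to `w`. Length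
-- one is excluded: there the sum is 1.
∑-patterns : ∀ w → 1 < length w → ∑ f (patterns w) ≡ 0ℤ
∑-patterns w l = begin
  ∑ f (patterns w)                               ≡⟨ ∑-same f (patterns-unique w) (patterns-unique (st w)) (≼-st⁺ w) (≼-st⁻ w) ⟩
  ∑ f (patterns (st w))                          ≡⟨ ∑-properPatterns (st-idem w) ⟨
  f (st w) ℤ.+ ∑ f (properPatterns (st w))
    ≡⟨ cong (λ z → z ℤ.+ ∑ f (properPatterns (st w))) (f-recursion (st w) (subst (1 <_) (sym (length-st w)) l)) ⟩
  - ∑ f (properPatterns (st w)) ℤ.+ ∑ f (properPatterns (st w)) ≡⟨ ℤₚ.+-inverseˡ (∑ f (properPatterns (st w))) ⟩
  0ℤ                                             ∎
  where open ≡-Reasoning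

-- If w is not standardised, every pattern of w is proper and f w = - ∑ f (patterns w) = 0.
f-st : ∀ w → 1 < length w → f (st w) ≡ 0ℤ → f w ≡ 0ℤ
f-st w l z with st w ≟L w
... | yes e = trans (cong f (sym e)) z
... | no ne = begin
  f w                       ≡⟨ f-recursion w l ⟩
  - ∑ f (properPatterns w)
    ≡⟨ cong (λ ws → - ∑ f ws) (Listₚ.filter-all (λ τ → ¬? (τ ≟L w))
         (All.tabulate λ i e → ne (subst (λ v → st v ≡ v) e (≼⇒st w i)))) ⟩
  - ∑ f (patterns w)        ≡⟨ cong -_ (∑-patterns w l) ⟩
  0ℤ                        ∎
  where open ≡-Reasoning

-- A formal combination of words stands for the function σ ↦ Σ c · [σ ≼ u] on patterns.
coef : List (ℤ × Word) → Word → ℤ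
coef []             σ = 0ℤ
coef ((c , u) ∷ cs) σ = c ℤ.* ind (σ ≼? u) ℤ.+ coef cs σ

∑-coef : ∀ {w} cs → All (λ cu → proj₂ cu ⊆ w × 1 < length (proj₂ cu)) cs →
  ∑ (λ σ → f σ ℤ.* coef cs σ) (patterns w) ≡ 0ℤ
∑-coef {w} [] [] = trans (∑-cong (patterns w) λ {σ} _ → ℤₚ.*-zeroʳ (f σ)) (∑-zero (patterns w))
∑-coef {w} ((c , u) ∷ cs) ((s , l) ∷ H) = begin
  ∑ (λ σ → f σ ℤ.* (c ℤ.* ind (σ ≼? u) ℤ.+ coef cs σ)) (patterns w)
    ≡⟨ ∑-cong (patterns w) (λ {σ} _ → trans (ℤₚ.*-distribˡ-+ (f σ) _ (coef cs σ))
         (cong (λ z → z ℤ.+ f σ ℤ.* coef cs σ) (x∙yz≈y∙xz (f σ) c (ind (σ ≼? u))))) ⟩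
  ∑ (λ σ → c ℤ.* (f σ ℤ.* ind (σ ≼? u)) ℤ.+ f σ ℤ.* coef cs σ) (patterns w)
    ≡⟨ ∑-+ _ _ (patterns w) ⟩
  ∑ (λ σ → c ℤ.* (f σ ℤ.* ind (σ ≼? u))) (patterns w) ℤ.+ ∑ (λ σ → f σ ℤ.* coef cs σ) (patterns w)
    ≡⟨ cong₂ ℤ._+_ (∑-*ˡ c _ (patterns w)) (∑-coef cs H) ⟩
  c ℤ.* ∑ (λ σ → f σ ℤ.* ind (σ ≼? u)) (patterns w) ℤ.+ 0ℤ
    ≡⟨ ℤₚ.+-identityʳ _ ⟩
  c ℤ.* ∑ (λ σ → f σ ℤ.* ind (σ ≼? u)) (patterns w)
    ≡⟨ cong (λ z → c ℤ.* z) (trans (∑-patterns-mono f s) (∑-patterns u l)) ⟩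
  c ℤ.* 0ℤ ≡⟨ ℤₚ.*-zeroʳ c ⟩
  0ℤ ∎
  where
  open ≡-Reasoning
  open import Algebra.Properties.CommutativeSemigroup ℤₚ.*-commutativeSemigroup using (x∙yz≈y∙xz)

-- Summed against `f` over the patterns of `w`, the indicator of `st w` gives `f (st w)` and the
-- combination gives 0. Agreement is demanded only where `f σ` is nonzero, because elsewhere both
-- summands are 0.
f-vanishes : ∀ {w} cs → All (λ cu → proj₂ cu ⊆ w × 1 < length (proj₂ cu)) cs →
  (∀ {σ} → σ ≼ w → f σ ≢ 0ℤ → coef cs σ ≡ ind (σ ≟L st w)) → f (st w) ≡ 0ℤ
f-vanishes {w} cs H pt = begin
  f (st w)                                           ≡⟨ ∑-one f (patterns-unique w) (⊆⇒≼ ⊆-refl) ⟨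
  ∑ (λ σ → f σ ℤ.* ind (σ ≟L st w)) (patterns w)     ≡⟨ ∑-cong (patterns w) step ⟩
  ∑ (λ σ → f σ ℤ.* coef cs σ) (patterns w)           ≡⟨ ∑-coef cs H ⟩
  0ℤ                                                 ∎
  where
  open ≡-Reasoning
  step : ∀ {σ} → σ ≼ w → f σ ℤ.* ind (σ ≟L st w) ≡ f σ ℤ.* coef cs σ
  step {σ} i with f σ ℤ.≟ 0ℤ
  ... | yes z rewrite z = refl
  ... | no nz = cong (λ z → f σ ℤ.* z) (sym (pt i nz))

-- Intervals

-- This replaces "the values of `m` form a set of consecutive integers" and makes sense for words
-- with arbitrary letters.
Separated : Word → Word → Set
Separated m xs = All (λ x → All (x <_) m ⊎ All (_< x) m) xs

separated-> : ∀ {m xs x y z} → Separated m xs → x ∈ xs → y ∈ m → z ∈ m → y < x → z < x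
separated-> S x∈ y∈ z∈ y<x with All.lookup S x∈
... | inj₁ b = contradiction (All.lookup b y∈) (ℕₚ.<-asym y<x)
... | inj₂ a = All.lookup a z∈

separated-< : ∀ {m xs x y z} → Separated m xs → x ∈ xs → y ∈ m → z ∈ m → x < y → x < z
separated-< S x∈ y∈ z∈ x<y with All.lookup S x∈
... | inj₁ b = All.lookup b z∈
... | inj₂ a = contradiction (All.lookup a y∈) (ℕₚ.<-asym x<y)

separated-⊆ : ∀ {m m′ xs xs′} → m′ ⊆ m → xs′ ⊆ xs → Separated m xs → Separated m′ xs′
separated-⊆ m′⊆m xs′⊆xs S = All.map
  (λ { (inj₁ b) → inj₁ (Subₚ.All-resp-⊆ m′⊆m b) ; (inj₂ a) → inj₂ (Subₚ.All-resp-⊆ m′⊆m a) })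
  (Subₚ.All-resp-⊆ xs′⊆xs S)

separated-map : ∀ {h m xs ws} → MonoOn h ws → m ⊆ ws → (∀ {x} → x ∈ xs → x ∈ ws) →
  Separated m xs → Separated (map h m) (map h xs)
separated-map {h} mono m⊆ws xs⊆ws S = Allₚ.map⁺ (All.tabulate λ x∈ → image x∈ (All.lookup S x∈))
  where
  image : ∀ {x} → x ∈ _ → _ → _
  image x∈ (inj₁ b) = inj₁ (Allₚ.map⁺ (All.tabulate λ y∈ → mono (xs⊆ws x∈) (lookup m⊆ws y∈) (All.lookup b y∈)))
  image x∈ (inj₂ a) = inj₂ (Allₚ.map⁺ (All.tabulate λ y∈ → mono (lookup m⊆ws y∈) (xs⊆ws x∈) (All.lookup a y∈)))

around⊆ : ∀ (p m s : Word) → p ++ s ⊆ p ++ m ++ s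
around⊆ p m s = Subₚ.++⁺ (⊆-refl {x = p}) (Subₚ.++⁺ˡ m ⊆-refl)

middle⊆ : ∀ (p m s : Word) → m ⊆ p ++ m ++ s
middle⊆ p m s = Subₚ.++⁺ˡ p (Subₚ.++⁺ʳ s ⊆-refl)

-- Neither `φ` nor `w` has to be standardised. Subwords of a block, such as `2 ∷ 0 ∷ []` inside
-- `p312`, can therefore serve as `φ` directly.
record HasInterval (φ w : Word) : Set where
  constructor interval
  field
    left right : Word
    place      : ℕ → ℕ
    split      : w ≡ left ++ map place φ ++ right
    mono       : MonoOn place φ
    separated  : Separated (map place φ) (left ++ right)

map-++₃ : ∀ (g : ℕ → ℕ) p m s → map g (p ++ m ++ s) ≡ map g p ++ map g m ++ map g s
map-++₃ g p m s = trans (Listₚ.map-++ g p (m ++ s)) (cong (map g p ++_) (Listₚ.map-++ g m s))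

MonoOn-∘ : ∀ {g h xs} → MonoOn h xs → MonoOn g (map h xs) → MonoOn (g ∘ h) xs
MonoOn-∘ {h = h} mh mg x∈ y∈ x<y = mg (∈-map⁺ h x∈) (∈-map⁺ h y∈) (mh x∈ y∈ x<y)

interval-map : ∀ {g φ w} → MonoOn g w → HasInterval φ w → HasInterval φ (map g w)
interval-map {g} {φ} mg (interval p s h refl mh S) = interval (map g p) (map g s) (g ∘ h)
  (trans (map-++₃ g p (map h φ) s) (cong (λ m → map g p ++ m ++ map g s) (sym (Listₚ.map-∘ φ))))
  (MonoOn-∘ mh (MonoOn-⊆ (middle⊆ p (map h φ) s) mg))
  (subst₂ Separated (sym (Listₚ.map-∘ φ)) (Listₚ.map-++ g p s)
    (separated-map mg (middle⊆ p (map h φ) s) (lookup (around⊆ p (map h φ) s)) S))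

interval-st : ∀ {φ w} → HasInterval φ w → HasInterval φ (st w)
interval-st {w = w} = interval-map (rank-mono w)

-- A letter outside the copy of `γ` either lies in the copy of `β`, where the monotone `g` carries
-- the separation over, or lies outside it and is separated from all of `β`.
interval-trans : ∀ {γ β w} → HasInterval γ β → HasInterval β w → HasInterval γ w
interval-trans {γ} (interval p s h refl mh S) (interval p′ s′ g refl mg S′) =
  interval (p′ ++ map g p) (map g s ++ s′) (g ∘ h) eq
    (MonoOn-∘ mh (MonoOn-⊆ γ⊆β mg))
    (subst (λ m → Separated m _) (sym (Listₚ.map-∘ γ)) (All.tabulate sep))
  where
  β = p ++ map h γ ++ s
  γ⊆β = middle⊆ p (map h γ) s
  inner : Separated (map g (map h γ)) (map g (p ++ s))
  inner = separated-map mg γ⊆β (lookup (around⊆ p (map h γ) s)) S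
  outer : Separated (map g (map h γ)) (p′ ++ s′)
  outer = separated-⊆ (Subₚ.map⁺ g γ⊆β) ⊆-refl S′
  sep : ∀ {x} → x ∈ (p′ ++ map g p) ++ map g s ++ s′ →
    All (x <_) (map g (map h γ)) ⊎ All (_< x) (map g (map h γ))
  sep x∈ with ∈-++⁻ (p′ ++ map g p) x∈
  sep x∈ | inj₁ i with ∈-++⁻ p′ i
  ... | inj₁ j = All.lookup outer (∈-++⁺ˡ j)
  ... | inj₂ j = All.lookup inner (subst (_ ∈_) (sym (Listₚ.map-++ g p s)) (∈-++⁺ˡ j))
  sep x∈ | inj₂ i with ∈-++⁻ (map g s) i
  ... | inj₁ j = All.lookup inner (subst (_ ∈_) (sym (Listₚ.map-++ g p s)) (∈-++⁺ʳ (map g p) j))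
  ... | inj₂ j = All.lookup outer (∈-++⁺ʳ p′ j)
  eq : p′ ++ map g β ++ s′ ≡ (p′ ++ map g p) ++ map (g ∘ h) γ ++ map g s ++ s′
  eq = begin
    p′ ++ map g β ++ s′
      ≡⟨ cong (λ m → p′ ++ m ++ s′) (map-++₃ g p (map h γ) s) ⟩
    p′ ++ (map g p ++ map g (map h γ) ++ map g s) ++ s′
      ≡⟨ cong (λ m → p′ ++ (map g p ++ m ++ map g s) ++ s′) (Listₚ.map-∘ γ) ⟨
    p′ ++ (map g p ++ map (g ∘ h) γ ++ map g s) ++ s′
      ≡⟨ cong (p′ ++_) (trans (Listₚ.++-assoc (map g p) _ s′)
           (cong (map g p ++_) (Listₚ.++-assoc (map (g ∘ h) γ) (map g s) s′))) ⟩
    p′ ++ map g p ++ map (g ∘ h) γ ++ map g s ++ s′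
      ≡⟨ Listₚ.++-assoc p′ (map g p) _ ⟨
    (p′ ++ map g p) ++ map (g ∘ h) γ ++ map g s ++ s′ ∎
    where open ≡-Reasoning

-- A letter outside the block compares in the same way with every letter of the block, so only the
-- relative order inside the block matters. This is what allows the content of an occurrence to be
-- exchanged for an equivalent one.
st-replace : ∀ {h φ α β} p s → MonoOn h φ → Separated (map h φ) (p ++ s) →
  α ⊆ φ → β ⊆ φ → st α ≡ st β → st (p ++ map h α ++ s) ≡ st (p ++ map h β ++ s)
st-replace {h} {φ} p s mono S α⊆φ β⊆φ e with st⇒iso e
... | zs , refl , refl , iso = begin
  st (p ++ map h (map proj₁ zs) ++ s) ≡⟨ cong st (proj proj₁ (λ _ → refl) (λ _ → refl)) ⟨
  st (map proj₁ ws)                   ≡⟨ iso⇒st ws iso′ ⟩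
  st (map proj₂ ws)                   ≡⟨ cong st (proj proj₂ (λ _ → refl) (λ _ → refl)) ⟩
  st (p ++ map h (map proj₂ zs) ++ s) ∎
  where
  open ≡-Reasoning
  dup : ℕ → ℕ × ℕ
  dup x = x , x
  both : ℕ × ℕ → ℕ × ℕ
  both (x , y) = h x , h y
  ws : List (ℕ × ℕ)
  ws = map dup p ++ map both zs ++ map dup s

  proj : (π : ℕ × ℕ → ℕ) → (∀ x → π (dup x) ≡ x) → (∀ z → π (both z) ≡ h (π z)) →
    map π ws ≡ p ++ map h (map π zs) ++ s
  proj π πdup πboth = trans (Listₚ.map-++ π (map dup p) _) (cong₂ _++_ (undup p)
    (trans (Listₚ.map-++ π (map both zs) _) (cong₂ _++_ unboth (undup s))))
    where
    undup : ∀ xs → map π (map dup xs) ≡ xs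
    undup xs = trans (sym (Listₚ.map-∘ xs)) (trans (Listₚ.map-cong πdup xs) (Listₚ.map-id xs))
    unboth : map π (map both zs) ≡ map h (map π zs)
    unboth = trans (sym (Listₚ.map-∘ zs)) (trans (Listₚ.map-cong πboth zs) (Listₚ.map-∘ zs))

  -- Sorting the pairs by where they come from reduces order isomorphism to four comparisons.
  data Origin : ℕ × ℕ → Set where
    outside : ∀ {x} → x ∈ p ++ s → Origin (x , x)
    inside  : ∀ {x y} → (x , y) ∈ zs → Origin (h x , h y)

  origin : ∀ {z} → z ∈ ws → Origin z
  origin z∈ with ∈-++⁻ (map dup p) z∈
  origin z∈ | inj₁ i with ∈-map⁻ dup i
  ... | _ , j , refl = outside (∈-++⁺ˡ j)
  origin z∈ | inj₂ i with ∈-++⁻ (map both zs) i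
  ... | inj₁ j with ∈-map⁻ both j
  ...   | _ , k , refl = inside k
  origin z∈ | inj₂ i | inj₂ j with ∈-map⁻ dup j
  ...   | _ , k , refl = outside (∈-++⁺ʳ p k)

  fst∈ : ∀ {x y} → (x , y) ∈ zs → x ∈ φ
  fst∈ i = lookup α⊆φ (∈-map⁺ proj₁ i)
  snd∈ : ∀ {x y} → (x , y) ∈ zs → y ∈ φ
  snd∈ i = lookup β⊆φ (∈-map⁺ proj₂ i)

  compare : ∀ {a b} → Origin a → Origin b →
    (proj₁ a < proj₁ b → proj₂ a < proj₂ b) × (proj₂ a < proj₂ b → proj₁ a < proj₁ b)
  compare (outside _) (outside _) = id , id
  compare (outside i) (inside j) =
    separated-< S i (∈-map⁺ h (fst∈ j)) (∈-map⁺ h (snd∈ j)) ,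
    separated-< S i (∈-map⁺ h (snd∈ j)) (∈-map⁺ h (fst∈ j))
  compare (inside j) (outside i) =
    separated-> S i (∈-map⁺ h (fst∈ j)) (∈-map⁺ h (snd∈ j)) ,
    separated-> S i (∈-map⁺ h (snd∈ j)) (∈-map⁺ h (fst∈ j))
  compare (inside i) (inside j) =
    (λ l → mono (snd∈ i) (snd∈ j) (proj₁ (iso i j) (MonoOn-reflects mono (fst∈ i) (fst∈ j) l))) ,
    (λ l → mono (fst∈ i) (fst∈ j) (proj₂ (iso i j) (MonoOn-reflects mono (snd∈ i) (snd∈ j) l)))

  iso′ : OrderIso ws
  iso′ a∈ b∈ = compare (origin a∈) (origin b∈)

-- A word with disjoint intervals φ and ψ, as a function of the content of the two intervals.
record TwoBlocks (φ ψ w : Word) : Set where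
  field
    fill        : Word → Word → Word
    fill-full   : fill φ ψ ≡ w
    fill-mono   : ∀ {α α′ β β′} → α ⊆ α′ → β ⊆ β′ → fill α β ⊆ fill α′ β′
    size        : ℕ
    fill-length : ∀ α β → length (fill α β) ≡ size ℕ.+ (length α ℕ.+ length β)
    occurrence  : ∀ {α β σ} → α ⊆ φ → β ⊆ ψ → σ ≼ fill α β →
      ∃₂ λ α′ β′ → α′ ⊆ α × β′ ⊆ β × HasInterval α′ σ × HasInterval β′ σ ×
        (∀ {α″ β″} → α″ ⊆ φ → β″ ⊆ ψ → st α′ ≡ st α″ → st β′ ≡ st β″ → σ ≼ fill α″ β″)

swapBlocks : ∀ {φ ψ w} → TwoBlocks φ ψ w → TwoBlocks ψ φ w
swapBlocks T = record
  { fill        = λ α β → fill β α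
  ; fill-full   = fill-full
  ; fill-mono   = λ s t → fill-mono t s
  ; size        = size
  ; fill-length = λ α β → trans (fill-length β α) (cong (size ℕ.+_) (ℕₚ.+-comm (length β) (length α)))
  ; occurrence  = λ s t i → let α′ , β′ , s′ , t′ , I , J , r = occurrence t s i in
      β′ , α′ , t′ , s′ , J , I , λ s″ t″ e e′ → r t″ s″ e′ e
  }
  where open TwoBlocks T

-- An occurrence of `σ` is cut along the five factors of the word. Its parts in the two blocks are
-- `α′` and `β′`, and separation passes to subwords, so both become intervals of `σ`.
twoBlocks : ∀ {φ ψ h k} p q s → MonoOn h φ → MonoOn k ψ →
  Separated (map h φ) (p ++ q ++ map k ψ ++ s) → Separated (map k ψ) ((p ++ map h φ ++ q) ++ s) →
  TwoBlocks φ ψ (p ++ map h φ ++ q ++ map k ψ ++ s)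
twoBlocks {φ} {ψ} {h} {k} p q s mh mk S T = record
  { fill        = λ α β → p ++ map h α ++ q ++ map k β ++ s
  ; fill-full   = refl
  ; fill-mono   = λ a b → Subₚ.++⁺ (⊆-refl {x = p}) (Subₚ.++⁺ (Subₚ.map⁺ h a)
                    (Subₚ.++⁺ (⊆-refl {x = q}) (Subₚ.++⁺ (Subₚ.map⁺ k b) ⊆-refl)))
  ; size        = length p ℕ.+ length q ℕ.+ length s
  ; fill-length = len
  ; occurrence  = occ
  }
  where
  assoc : ∀ (p m q r : Word) → p ++ m ++ q ++ r ≡ (p ++ m ++ q) ++ r
  assoc p m q r = trans (cong (p ++_) (sym (Listₚ.++-assoc m q r))) (sym (Listₚ.++-assoc p (m ++ q) r))

  len : ∀ α β → length (p ++ map h α ++ q ++ map k β ++ s) ≡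
    length p ℕ.+ length q ℕ.+ length s ℕ.+ (length α ℕ.+ length β)
  len α β
    rewrite Listₚ.length-++ p {map h α ++ q ++ map k β ++ s} | Listₚ.length-++ (map h α) {q ++ map k β ++ s}
          | Listₚ.length-++ q {map k β ++ s} | Listₚ.length-++ (map k β) {s}
          | Listₚ.length-map h α | Listₚ.length-map k β =
    solve 5 (λ p a q b s → p :+ (a :+ (q :+ (b :+ s))) := p :+ q :+ s :+ (a :+ b)) refl
      (length p) (length α) (length q) (length β) (length s)
    where
    open import Data.Nat.Solver
    open +-*-Solver

  occ : ∀ {α β σ} → α ⊆ φ → β ⊆ ψ → σ ≼ (p ++ map h α ++ q ++ map k β ++ s) →
    ∃₂ λ α′ β′ → α′ ⊆ α × β′ ⊆ β × HasInterval α′ σ × HasInterval β′ σ ×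
      (∀ {α″ β″} → α″ ⊆ φ → β″ ⊆ ψ → st α′ ≡ st α″ → st β′ ≡ st β″ →
        σ ≼ (p ++ map h α″ ++ q ++ map k β″ ++ s))
  occ {α} {β} α⊆φ β⊆ψ i with ≼⇒⊆ (p ++ map h α ++ q ++ map k β ++ s) i
  ... | _ , u⊆ , refl with ⊆-++⁻ p _ u⊆
  ... | p′ , _ , refl , p⊆ , u⊆₁ with ⊆-++⁻ (map h α) _ u⊆₁
  ... | m , _ , refl , m⊆ , u⊆₂ with ⊆-++⁻ q _ u⊆₂ | ⊆-map⁻ h α m⊆
  ... | q′ , _ , refl , q⊆ , u⊆₃ | α′ , refl , α′⊆α with ⊆-++⁻ (map k β) s u⊆₃
  ... | n , s′ , refl , n⊆ , s⊆ with ⊆-map⁻ k β n⊆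
  ... | β′ , refl , β′⊆β = α′ , β′ , α′⊆α , β′⊆β ,
    interval-st (interval p′ (q′ ++ map k β′ ++ s′) h refl (MonoOn-⊆ α′⊆φ mh) (separated-⊆ (Subₚ.map⁺ h α′⊆φ) ⊆-refl S′)) ,
    interval-st (interval (p′ ++ map h α′ ++ q′) s′ k (assoc p′ (map h α′) q′ _) (MonoOn-⊆ β′⊆ψ mk)
      (separated-⊆ (Subₚ.map⁺ k β′⊆ψ) ⊆-refl (T′ α′⊆φ))) ,
    -- One replacement per block, with a reassociation that moves the second block into the middle.
    -- The second replacement takes place after the first block already holds `α″`.
    λ {α″} {β″} α″⊆φ β″⊆ψ e e′ → subst (_≼ (p ++ map h α″ ++ q ++ map k β″ ++ s))
      (sym (trans (st-replace p′ (q′ ++ map k β′ ++ s′) mh S′ α′⊆φ α″⊆φ e)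
        (trans (cong st (assoc p′ (map h α″) q′ _))
        (trans (st-replace (p′ ++ map h α″ ++ q′) s′ mk (T′ α″⊆φ) β′⊆ψ β″⊆ψ e′)
               (cong st (sym (assoc p′ (map h α″) q′ _)))))))
      (⊆⇒≼ (Subₚ.++⁺ p⊆ (Subₚ.++⁺ (⊆-refl {x = map h α″}) (Subₚ.++⁺ q⊆ (Subₚ.++⁺ (⊆-refl {x = map k β″}) s⊆)))))
    where
    α′⊆φ = ⊆-trans α′⊆α α⊆φ
    β′⊆ψ = ⊆-trans β′⊆β β⊆ψ
    S′ : Separated (map h φ) (p′ ++ q′ ++ map k β′ ++ s′)
    S′ = separated-⊆ ⊆-refl (Subₚ.++⁺ p⊆ (Subₚ.++⁺ q⊆ (Subₚ.++⁺ (Subₚ.map⁺ k β′⊆ψ) s⊆))) S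
    T′ : ∀ {γ} → γ ⊆ φ → Separated (map k ψ) ((p′ ++ map h γ ++ q′) ++ s′)
    T′ γ⊆φ = separated-⊆ ⊆-refl (Subₚ.++⁺ (Subₚ.++⁺ p⊆ (Subₚ.++⁺ (Subₚ.map⁺ h γ⊆φ) q⊆)) s⊆) T

-- Pairs of intervals that force a zero

-- The two intervals are not assumed disjoint, since in the applications they come from different
-- occurrences of one pattern.
Kill : Word → Word → Set
Kill φ ψ = ∀ w → HasInterval φ w → HasInterval ψ w → f (st w) ≡ 0ℤ

Disjoint : Word → Word → Set
Disjoint φ ψ = ∀ {w} → HasInterval φ w → HasInterval ψ w → TwoBlocks φ ψ w

-- `cover` and `meet` support inclusion-exclusion on the first block. `classify` treats the second:
-- a subword of `ψ` fits into `ψ′`, or contains `ψ` so that induction applies, or contains some `γ`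
-- already known to force a zero together with `φ`.
record Reduction (φ ψ : Word) : Set where
  field
    φ₁ φ₂ φ₀ ψ′ : Word
    φ₁⊆ : φ₁ ⊆ φ
    φ₂⊆ : φ₂ ⊆ φ
    φ₀⊆φ₁ : φ₀ ⊆ φ₁
    φ₀⊆φ₂ : φ₀ ⊆ φ₂
    ψ′⊆ : ψ′ ⊆ ψ
    φ₁-short : length φ₁ < length φ
    φ₂-short : length φ₂ < length φ
    ψ′-short : length ψ′ < length ψ
    φ₀-nonempty : 0 < length φ₀
    ψ′-nonempty : 0 < length ψ′
    cover : ∀ {α} → α ⊆ φ → α ≡ φ ⊎ st α ≼ φ₁ ⊎ st α ≼ φ₂
    meet : ∀ {α₁ α₂} → α₁ ⊆ φ₁ → α₂ ⊆ φ₂ → st α₁ ≼ φ₀ ⊎ st α₂ ≼ φ₀ ⊎ Kill α₁ α₂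
    classify : ∀ {β} → β ⊆ ψ → st β ≼ ψ′ ⊎ HasInterval ψ β ⊎ (∃ λ γ → Kill φ γ × HasInterval γ β)

-- The induction step for a reduction

module _ {φ ψ : Word} (R : Reduction φ ψ) where
  open Reduction R

  private
    φ₀⊆ : φ₀ ⊆ φ
    φ₀⊆ = ⊆-trans φ₀⊆φ₁ φ₁⊆

    module _ {w} (T : TwoBlocks φ ψ w)
             (IH : ∀ v → length v < length w → HasInterval φ v → HasInterval ψ v → f (st v) ≡ 0ℤ) where
      open TwoBlocks T

      fill-⊆ : ∀ {α β} → α ⊆ φ → β ⊆ ψ → fill α β ⊆ w
      fill-⊆ {α} {β} a b = subst (fill α β ⊆_) fill-full (fill-mono a b)

      represent : ∀ {α} ws → st α ≼ ws → ∃ λ α″ → α″ ⊆ ws × st α ≡ st α″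
      represent ws i = ≼⇒⊆ ws i

      module _ {σ} (σ≼w : σ ≼ w) (fσ≢0 : f σ ≢ 0ℤ) where

        stσ : st σ ≡ σ
        stσ = ≼⇒st w σ≼w

        killed : ∀ {A : Set} → f (st σ) ≡ 0ℤ → A
        killed z = contradiction (subst (λ τ → f τ ≡ 0ℤ) stσ z) fσ≢0

        -- The two occurrences give `σ` intervals `α₁` inside `φ₁` and `α₂` inside `φ₂`. By `meet`,
        -- one of them can be moved into `φ₀`, or together they force `f σ` to be 0.
        meets : ∀ {β} → β ⊆ ψ → σ ≼ fill φ₁ β → σ ≼ fill φ₂ β → σ ≼ fill φ₀ β
        meets b i j with occurrence φ₁⊆ b i | occurrence φ₂⊆ b j
        ... | α₁ , β₁ , a₁ , b₁ , I₁ , _ , r₁ | α₂ , β₂ , a₂ , b₂ , I₂ , _ , r₂ with meet a₁ a₂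
        ... | inj₂ (inj₂ K) = killed (K σ I₁ I₂)
        ... | inj₁ k with represent φ₀ k
        ...   | α″ , a″ , e = ≼-mono (fill-mono a″ b₁) (r₁ (⊆-trans a″ φ₀⊆) (⊆-trans b₁ b) e refl)
        meets b i j | α₁ , β₁ , a₁ , b₁ , I₁ , _ , r₁ | α₂ , β₂ , a₂ , b₂ , I₂ , _ , r₂ | inj₂ (inj₁ k)
          with represent φ₀ k
        ... | α″ , a″ , e = ≼-mono (fill-mono a″ b₂) (r₂ (⊆-trans a″ φ₀⊆) (⊆-trans b₂ b) e refl)

        -- Every occurrence of σ in fill φ β uses the whole block φ.
        Full : Word → Set
        Full β = σ ≼ fill φ β × ¬ σ ≼ fill φ₁ β × ¬ σ ≼ fill φ₂ β

        signature : Word → ℤ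
        signature β = ind (σ ≼? fill φ β) ℤ.- ind (σ ≼? fill φ₁ β) ℤ.- ind (σ ≼? fill φ₂ β) ℤ.+ ind (σ ≼? fill φ₀ β)

        -- Monotonicity of `fill` and `meets` leave five of the sixteen combinations of answers,
        -- those of the first five clauses. Among them the alternating sum is 1 exactly in the full
        -- case.
        signature-value : ∀ {β} → β ⊆ ψ → Full β × signature β ≡ 1ℤ ⊎ ¬ Full β × signature β ≡ 0ℤ
        signature-value {β} b with σ ≼? fill φ β | σ ≼? fill φ₁ β | σ ≼? fill φ₂ β | σ ≼? fill φ₀ β
        ... | yes _ | yes p  | yes _ | yes _ = inj₂ ((λ F → proj₁ (proj₂ F) p) , refl)
        ... | yes _ | yes p  | no _  | no _  = inj₂ ((λ F → proj₁ (proj₂ F) p) , refl)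
        ... | yes _ | no _   | yes q | no _  = inj₂ ((λ F → proj₂ (proj₂ F) q) , refl)
        ... | yes i | no ¬p  | no ¬q | no _  = inj₁ ((i , ¬p , ¬q) , refl)
        ... | no ¬i | no _   | no _  | no _  = inj₂ ((λ F → ¬i (proj₁ F)) , refl)
        ... | _     | yes p  | yes q | no ¬r = contradiction (meets b p q) ¬r
        ... | _     | no ¬p  | _     | yes r = contradiction (≼-mono (fill-mono φ₀⊆φ₁ ⊆-refl) r) ¬p
        ... | _     | _      | no ¬q | yes r = contradiction (≼-mono (fill-mono φ₀⊆φ₂ ⊆-refl) r) ¬q
        ... | no ¬i | yes p  | _     | _     = contradiction (≼-mono (fill-mono φ₁⊆ ⊆-refl) p) ¬i
        ... | no ¬i | _      | yes q | _     = contradiction (≼-mono (fill-mono φ₂⊆ ⊆-refl) q) ¬i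

        -- By `cover`, a content other than `φ` could be moved into `φ₁` or `φ₂`, which fullness
        -- forbids.
        full-occurrence : ∀ {β} → β ⊆ ψ → Full β → ∃ λ β′ → β′ ⊆ β × HasInterval φ σ × HasInterval β′ σ ×
          (∀ {β″} → β″ ⊆ ψ → st β′ ≡ st β″ → σ ≼ fill φ β″)
        full-occurrence b (i , ¬p , ¬q) with occurrence ⊆-refl b i
        ... | α , β′ , a , b′ , I , J , r with cover a
        ... | inj₁ refl = β′ , b′ , I , J , λ b″ e → r ⊆-refl b″ refl e
        ... | inj₂ (inj₁ k) with represent φ₁ k
        ...   | _ , a″ , e = contradiction (≼-mono (fill-mono a″ b′) (r (⊆-trans a″ φ₁⊆) (⊆-trans b′ b) e refl)) ¬p
        full-occurrence b (i , ¬p , ¬q) | α , β′ , a , b′ , I , J , r | inj₂ (inj₂ k) with represent φ₂ k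
        ... | _ , a″ , e = contradiction (≼-mono (fill-mono a″ b′) (r (⊆-trans a″ φ₂⊆) (⊆-trans b′ b) e refl)) ¬q

        module _ (σ≢w : σ ≢ st w) where

          -- The other two outcomes of `classify` contradict `f σ ≢ 0ℤ`: one by induction, since `σ`
          -- is shorter than `w`, the other by a known pair.
          reduces : ∀ {β} → β ⊆ ψ → HasInterval φ σ → HasInterval β σ → st β ≼ ψ′
          reduces b I J with classify b
          ... | inj₁ k = k
          ... | inj₂ (inj₁ J′) = killed (IH σ (≼-length-< w σ≼w σ≢w) I (interval-trans J′ J))
          ... | inj₂ (inj₂ (γ , K , J′)) = killed (K σ I (interval-trans J′ J))

          drops : ∀ {α} → α ⊆ φ → HasInterval φ σ → σ ≼ fill α ψ → σ ≼ fill α ψ′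
          drops a I i with occurrence a ⊆-refl i
          ... | α′ , β′ , a′ , b′ , _ , J , r with represent ψ′ (reduces b′ I J)
          ... | β″ , b″ , e = ≼-mono (fill-mono a′ b″) (r (⊆-trans a′ a) (⊆-trans b″ ψ′⊆) refl e)

          full-down : Full ψ → Full ψ′
          full-down F@(i , ¬p , ¬q) with full-occurrence ⊆-refl F
          ... | _ , _ , I , _ = drops ⊆-refl I i ,
            ¬p ∘ ≼-mono (fill-mono ⊆-refl ψ′⊆) , ¬q ∘ ≼-mono (fill-mono ⊆-refl ψ′⊆)

          full-up : Full ψ′ → Full ψ
          full-up F@(i , ¬p , ¬q) with full-occurrence ψ′⊆ F
          -- The interval `φ` found in `σ` makes `drops` available for `φ₁` and `φ₂`, so an
          -- occurrence there with `ψ` would already be one with `ψ′`.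
          ... | _ , _ , I , _ = ≼-mono (fill-mono ⊆-refl ψ′⊆) i , ¬p ∘ drops φ₁⊆ I , ¬q ∘ drops φ₂⊆ I

        fill-short : ∀ {α β} → length α ℕ.+ length β < length φ ℕ.+ length ψ → σ ≼ fill α β → σ ≢ st w
        fill-short {α} {β} l i e = ℕₚ.<⇒≱ (ℕₚ.+-monoʳ-< size l) (begin
          size ℕ.+ (length φ ℕ.+ length ψ) ≡⟨ fill-length φ ψ ⟨
          length (fill φ ψ)                ≡⟨ cong length fill-full ⟩
          length w                         ≡⟨ length-st w ⟨
          length (st w)                    ≡⟨ cong length e ⟨
          length σ                         ≤⟨ ≼-length (fill α β) i ⟩
          length (fill α β)                ≡⟨ fill-length α β ⟩
          size ℕ.+ (length α ℕ.+ length β) ∎)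
          where open ℕₚ.≤-Reasoning

        -- For `σ` other than `st w`, fullness at `ψ` and at `ψ′` are equivalent and the difference
        -- is 0. For `σ` equal to `st w`, length rules out every word with a shrunken block, so only
        -- fullness at `ψ` holds and the difference is 1.
        signatures : signature ψ ℤ.- signature ψ′ ≡ ind (σ ≟L st w)
        signatures with σ ≟L st w | signature-value {ψ} ⊆-refl | signature-value ψ′⊆
        ... | no ne | inj₁ (_ , e) | inj₁ (_ , e′) rewrite e | e′ = refl
        ... | no ne | inj₂ (_ , e) | inj₂ (_ , e′) rewrite e | e′ = refl
        ... | no ne | inj₁ (F , _) | inj₂ (¬F , _) = contradiction (full-down ne F) ¬F
        ... | no ne | inj₂ (¬F , _) | inj₁ (F , _) = contradiction (full-up ne F) ¬F
        ... | yes q | inj₁ (_ , e) | inj₂ (_ , e′) rewrite e | e′ = refl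
        ... | yes q | _ | inj₁ (F , _) =
          contradiction q (fill-short (ℕₚ.+-monoʳ-< (length φ) ψ′-short) (proj₁ F))
        ... | yes q | inj₂ (¬F , _) | _ = contradiction
          ( subst (_≼ fill φ ψ) (sym q) (subst (λ v → st w ≼ v) (sym fill-full) (⊆⇒≼ ⊆-refl))
          , (λ i → fill-short (ℕₚ.+-monoˡ-< (length ψ) φ₁-short) i q)
          , (λ i → fill-short (ℕₚ.+-monoˡ-< (length ψ) φ₂-short) i q)) ¬F

      combination : List (ℤ × Word)
      combination =
        (1ℤ  , fill φ ψ)  ∷ (-1ℤ , fill φ₁ ψ)  ∷ (-1ℤ , fill φ₂ ψ)  ∷ (1ℤ  , fill φ₀ ψ) ∷
        (-1ℤ , fill φ ψ′) ∷ (1ℤ  , fill φ₁ ψ′) ∷ (1ℤ  , fill φ₂ ψ′) ∷ (-1ℤ , fill φ₀ ψ′) ∷ []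

      -- Each of the eight words keeps at least `φ₀` and `ψ′` in its blocks, hence has two letters.
      combination-valid : All (λ cu → proj₂ cu ⊆ w × 1 < length (proj₂ cu)) combination
      combination-valid =
        valid ⊆-refl φ₀⊆ ⊆-refl ψ′⊆ ∷ valid φ₁⊆ φ₀⊆φ₁ ⊆-refl ψ′⊆ ∷
        valid φ₂⊆ φ₀⊆φ₂ ⊆-refl ψ′⊆ ∷ valid φ₀⊆ ⊆-refl ⊆-refl ψ′⊆ ∷
        valid ⊆-refl φ₀⊆ ψ′⊆ ⊆-refl ∷ valid φ₁⊆ φ₀⊆φ₁ ψ′⊆ ⊆-refl ∷
        valid φ₂⊆ φ₀⊆φ₂ ψ′⊆ ⊆-refl ∷ valid φ₀⊆ ⊆-refl ψ′⊆ ⊆-refl ∷ []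
        where
        valid : ∀ {α β} → α ⊆ φ → φ₀ ⊆ α → β ⊆ ψ → ψ′ ⊆ β → fill α β ⊆ w × 1 < length (fill α β)
        valid {α} {β} a a₀ b b₀ = fill-⊆ a b , (begin
          2                                ≤⟨ ℕₚ.+-mono-≤ (ℕₚ.≤-trans φ₀-nonempty (Subₚ.length-mono-≤ a₀))
                                                         (ℕₚ.≤-trans ψ′-nonempty (Subₚ.length-mono-≤ b₀)) ⟩
          length α ℕ.+ length β            ≤⟨ ℕₚ.m≤n+m _ size ⟩
          size ℕ.+ (length α ℕ.+ length β) ≡⟨ fill-length α β ⟨
          length (fill α β)                ∎)
          where open ℕₚ.≤-Reasoning

      coef-combination : ∀ {σ} (σ≼w : σ ≼ w) (fσ≢0 : f σ ≢ 0ℤ) →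
        coef combination σ ≡ signature σ≼w fσ≢0 ψ ℤ.- signature σ≼w fσ≢0 ψ′
      coef-combination {σ} _ _ = solve 8
        (λ a b c d a′ b′ c′ d′ →
          con 1ℤ :* a :+ (con -1ℤ :* b :+ (con -1ℤ :* c :+ (con 1ℤ :* d :+
          (con -1ℤ :* a′ :+ (con 1ℤ :* b′ :+ (con 1ℤ :* c′ :+ (con -1ℤ :* d′ :+ con 0ℤ)))))))
          := (a :- b :- c :+ d) :- (a′ :- b′ :- c′ :+ d′)) refl
        (i φ ψ) (i φ₁ ψ) (i φ₂ ψ) (i φ₀ ψ) (i φ ψ′) (i φ₁ ψ′) (i φ₂ ψ′) (i φ₀ ψ′)
        where
        open import Data.Integer.Solver
        open +-*-Solver
        i : Word → Word → ℤ
        i α β = ind (σ ≼? fill α β)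

      block-step : f (st w) ≡ 0ℤ
      block-step = f-vanishes combination combination-valid λ σ≼w fσ≢0 →
        trans (coef-combination σ≼w fσ≢0) (signatures σ≼w fσ≢0)

  reduction⇒kill : Disjoint φ ψ → Kill φ ψ
  reduction⇒kill D w = <-rec P step (length w) w refl
    where
    P : ℕ → Set
    P n = ∀ w → length w ≡ n → HasInterval φ w → HasInterval ψ w → f (st w) ≡ 0ℤ
    step : ∀ n → (∀ {m} → m < n → P m) → P n
    step n IH w refl I J = block-step (D I J) λ v l → IH l v refl

-- Disjointness of intervals

prefixes : ∀ (p p′ : Word) {s s′} → p ++ s ≡ p′ ++ s′ →
  (∃ λ r → p′ ≡ p ++ r × s ≡ r ++ s′) ⊎ (∃ λ r → p ≡ p′ ++ r × s′ ≡ r ++ s)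
prefixes []      p′       e = inj₁ (p′ , refl , e)
prefixes (x ∷ p) []       e = inj₂ (x ∷ p , refl , sym e)
prefixes (x ∷ p) (y ∷ p′) e with Listₚ.∷-injective e
... | refl , e′ with prefixes p p′ e′
... | inj₁ (r , q , t) = inj₁ (r , cong (x ∷_) q , t)
... | inj₂ (r , q , t) = inj₂ (r , cong (x ∷_) q , t)

-- An interval ψ that starts after an interval φ starts after the end of φ.
After : Word → Word → Set
After φ ψ = ∀ {h k p r s s′} → MonoOn h φ → MonoOn k ψ →
  Separated (map h φ) (p ++ s) → Separated (map k ψ) ((p ++ r) ++ s′) →
  map h φ ++ s ≡ r ++ map k ψ ++ s′ → ∃ λ q → r ≡ map h φ ++ q

-- The parts of the word before the two intervals are comparable prefixes, which tells which
-- interval starts first. A common start is the case where `r` is empty.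
after⇒disjoint : ∀ {φ ψ} → After φ ψ → After ψ φ → Disjoint φ ψ
after⇒disjoint {φ} {ψ} A B (interval p s h e mh S) (interval p′ s′ k e′ mk S′)
  with prefixes p p′ (trans (sym e) e′)
... | inj₁ (r , refl , t) with A {h} {k} {p} {r} mh mk S S′ t
...   | q , refl = subst (TwoBlocks φ ψ) (sym (trans e (cong (p ++_) (trans t (Listₚ.++-assoc (map h φ) q _)))))
        (twoBlocks p q s′ mh mk (subst (λ v → Separated (map h φ) (p ++ v)) s≡ S) S′)
  where
  s≡ : s ≡ q ++ map k ψ ++ s′
  s≡ = Listₚ.++-cancelˡ (map h φ) s _ (trans t (Listₚ.++-assoc (map h φ) q _))
after⇒disjoint {φ} {ψ} A B (interval p s h e mh S) (interval p′ s′ k e′ mk S′)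
  | inj₂ (r , refl , t) with B {k} {h} {p′} {r} mk mh S′ S t
... | q , refl = swapBlocks (subst (TwoBlocks ψ φ) (sym (trans e′ (cong (p′ ++_) (trans t (Listₚ.++-assoc (map k ψ) q _)))))
        (twoBlocks p′ q s mk mh (subst (λ v → Separated (map k ψ) (p′ ++ v)) s≡ S′) S))
  where
  s≡ : s′ ≡ q ++ map h φ ++ s
  s≡ = Listₚ.++-cancelˡ (map k ψ) s′ _ (trans t (Listₚ.++-assoc (map k ψ) q _))

absurd-< : ∀ {x y} {A : Set} → x < y → y < x → A
absurd-< l l′ = contradiction l′ (ℕₚ.<-asym l)

pattern #0 = here refl
pattern #1 = there #0
pattern #2 = there #1
pattern #3 = there #2
pattern #4 = there #3

p12 p21 p123 p2314 : Word
p12   = 0 ∷ 1 ∷ []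
p21   = 1 ∷ 0 ∷ []
p123  = 0 ∷ 1 ∷ 2 ∷ []
p2314 = 1 ∷ 2 ∷ 0 ∷ 3 ∷ []

lt : ∀ {m n} {l : True (m <? n)} → m < n
lt {l = l} = toWitness l


inside-right : ∀ (p : Word) {s x} → x ∈ s → x ∈ p ++ s
inside-right p = ∈-++⁺ʳ p

inside-left : ∀ (p : Word) {r s : Word} {x} → x ∈ r → x ∈ (p ++ r) ++ s
inside-left p = ∈-++⁺ˡ ∘ ∈-++⁺ʳ p

-- The length of `r` is the shift between the two starts. If they share only the letter `b`, then
-- `d` lies outside the first interval and below `b`, so `d < a`; but `a` lies outside the second
-- and below `b`, so `a < d`.
after-12-21 : After p12 p21
after-12-21 {h} {k} {p} {r} mh mk = go r (mh #0 #1 lt) (mk #1 #0 lt)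
  where
  go : ∀ r {a b c d s s′} → a < b → d < c → Separated (a ∷ b ∷ []) (p ++ s) →
    Separated (c ∷ d ∷ []) ((p ++ r) ++ s′) → a ∷ b ∷ s ≡ r ++ c ∷ d ∷ s′ → ∃ λ q → r ≡ a ∷ b ∷ q
  go []          a<b d<c S T refl = absurd-< a<b d<c
  go (_ ∷ [])    a<b d<b S T refl =
    absurd-< (separated-< S (inside-right p #0) #1 #0 d<b) (separated-< T (inside-left p #0) #0 #1 a<b)
  go (_ ∷ _ ∷ q) a<b d<c S T refl = q , refl

after-21-12 : After p21 p12
after-21-12 {h} {k} {p} {r} mh mk = go r (mh #1 #0 lt) (mk #0 #1 lt)
  where
  go : ∀ r {a b c d s s′} → b < a → c < d → Separated (a ∷ b ∷ []) (p ++ s) →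
    Separated (c ∷ d ∷ []) ((p ++ r) ++ s′) → a ∷ b ∷ s ≡ r ++ c ∷ d ∷ s′ → ∃ λ q → r ≡ a ∷ b ∷ q
  go []          b<a c<d S T refl = absurd-< b<a c<d
  go (_ ∷ [])    b<a b<d S T refl =
    absurd-< (separated-> S (inside-right p #0) #1 #0 b<d) (separated-> T (inside-left p #0) #0 #1 b<a)
  go (_ ∷ _ ∷ q) b<a c<d S T refl = q , refl

-- This covers 123, 2314 and 23514 together: each begins with an ascent `d < e` and has a further
-- letter `x` above `d`. An overlap in one letter puts `e` both above and below `a`, and an overlap
-- in two letters does the same to `x`.
after-312 : ∀ {d e x t} → d < e → d < x → x ∈ t → After p312 (d ∷ e ∷ t)
after-312 d<e d<x x∈t {h} {k} {p} {r} mh mk =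
  go r (mh #1 #2 lt) (mh #2 #0 lt) (mk #0 #1 d<e) (mk #0 (there (there x∈t)) d<x) (∈-map⁺ k x∈t)
  where
  go : ∀ r {a b c d e x t s s′} → b < c → c < a → d < e → d < x → x ∈ t →
    Separated (a ∷ b ∷ c ∷ []) (p ++ s) → Separated (d ∷ e ∷ t) ((p ++ r) ++ s′) →
    a ∷ b ∷ c ∷ s ≡ r ++ d ∷ e ∷ t ++ s′ → ∃ λ q → r ≡ a ∷ b ∷ c ∷ q
  go []              b<c c<a d<e d<x x∈t S T q with Listₚ.∷-injective q
  ... | refl , q′ with Listₚ.∷-injectiveˡ q′
  ... | refl = absurd-< d<e (ℕₚ.<-trans b<c c<a)
  go (_ ∷ [])        b<c c<a d<e d<x x∈t S T refl =
    absurd-< (separated-> S (inside-right p (∈-++⁺ˡ x∈t)) #1 #0 d<x)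
             (separated-> T (inside-left p #0) #0 (there (there x∈t)) (ℕₚ.<-trans b<c c<a))
  go (_ ∷ _ ∷ [])    b<c c<a d<e d<x x∈t S T refl =
    absurd-< (separated-> S (inside-right p #0) #2 #0 d<e) (separated-> T (inside-left p #0) #0 #1 c<a)
  go (_ ∷ _ ∷ _ ∷ q) b<c c<a d<e d<x x∈t S T refl = q , refl

after-123-312 : After p123 p312
after-123-312 {h} {k} {p} {r} mh mk = go r (mh #0 #1 lt) (mh #1 #2 lt) (mk #1 #0 lt)
  where
  go : ∀ r {a b c d e f s s′} → d < e → e < f → b < a →
    Separated (d ∷ e ∷ f ∷ []) (p ++ s) → Separated (a ∷ b ∷ c ∷ []) ((p ++ r) ++ s′) →
    d ∷ e ∷ f ∷ s ≡ r ++ a ∷ b ∷ c ∷ s′ → ∃ λ q → r ≡ d ∷ e ∷ f ∷ q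
  go []              d<e e<f b<a S T refl = absurd-< d<e b<a
  go (_ ∷ [])        d<e e<f b<a S T refl = absurd-< e<f b<a
  go (_ ∷ _ ∷ [])    d<e e<f b<a S T refl =
    absurd-< (separated-< S (inside-right p #0) #2 #0 b<a)
             (separated-< T (inside-left p #0) #0 #1 (ℕₚ.<-trans d<e e<f))
  go (_ ∷ _ ∷ _ ∷ q) d<e e<f b<a S T refl = q , refl

after-2314-312 : After p2314 p312
after-2314-312 {h} {k} {p} {r} mh mk =
  go r (mh #0 #1 lt) (mh #1 #3 lt) (mh #2 #3 lt) (mk #1 #0 lt) (mk #2 #0 lt)
  where
  go : ∀ r {a b c d e f g s s′} → d < e → e < g → f < g → b < a → c < a →
    Separated (d ∷ e ∷ f ∷ g ∷ []) (p ++ s) → Separated (a ∷ b ∷ c ∷ []) ((p ++ r) ++ s′) →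
    d ∷ e ∷ f ∷ g ∷ s ≡ r ++ a ∷ b ∷ c ∷ s′ → ∃ λ q → r ≡ d ∷ e ∷ f ∷ g ∷ q
  go []                  d<e e<g f<g b<a c<a S T refl = absurd-< d<e b<a
  go (_ ∷ [])            d<e e<g f<g b<a c<a S T refl = absurd-< e<g c<a
  go (_ ∷ _ ∷ [])        d<e e<g f<g b<a c<a S T refl = absurd-< f<g b<a
  go (_ ∷ _ ∷ _ ∷ [])    d<e e<g f<g b<a c<a S T refl =
    absurd-< (separated-< S (inside-right p #0) #3 #0 b<a)
             (separated-< T (inside-left p #0) #0 #1 (ℕₚ.<-trans d<e e<g))
  go (_ ∷ _ ∷ _ ∷ _ ∷ q) d<e e<g f<g b<a c<a S T refl = q , refl

after-23514-312 : After p23514 p312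
after-23514-312 {h} {k} {p} {r} mh mk =
  go r (mh #0 #1 lt) (mh #1 #2 lt) (mh #3 #0 lt) (mh #3 #4 lt) (mh #0 #4 lt) (mk #1 #0 lt)
  where
  go : ∀ r {a b c d e f g j s s′} → d < e → e < f → g < d → g < j → d < j → b < a →
    Separated (d ∷ e ∷ f ∷ g ∷ j ∷ []) (p ++ s) → Separated (a ∷ b ∷ c ∷ []) ((p ++ r) ++ s′) →
    d ∷ e ∷ f ∷ g ∷ j ∷ s ≡ r ++ a ∷ b ∷ c ∷ s′ → ∃ λ q → r ≡ d ∷ e ∷ f ∷ g ∷ j ∷ q
  go []                      d<e e<f g<d g<j d<j b<a S T refl = absurd-< d<e b<a
  go (_ ∷ [])                d<e e<f g<d g<j d<j b<a S T refl = absurd-< e<f b<a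
  -- Here order alone gives no contradiction, since the last three letters of 23514 form a 312. The
  -- letter 2 lies outside them and below 5, so it would have to lie below 1.
  go (_ ∷ _ ∷ [])            d<e e<f g<d g<j d<j b<a S T refl =
    absurd-< g<d (separated-< T (inside-left p #0) #0 #1 (ℕₚ.<-trans d<e e<f))
  go (_ ∷ _ ∷ _ ∷ [])        d<e e<f g<d g<j d<j b<a S T refl = absurd-< g<j b<a
  go (_ ∷ _ ∷ _ ∷ _ ∷ [])    d<e e<f g<d g<j d<j b<a S T refl =
    absurd-< (separated-< S (inside-right p #0) #4 #0 b<a) (separated-< T (inside-left p #0) #0 #1 d<j)
  go (_ ∷ _ ∷ _ ∷ _ ∷ _ ∷ q) d<e e<f g<d g<j d<j b<a S T refl = q , refl

-- The four pairs

-- A candidate for `place`, matching letters by position. `intervalAt` checks everything about it,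
-- so the default value 0 carries no meaning.
assign : Word → Word → ℕ → ℕ
assign (x ∷ xs) (y ∷ ys) z = if x ≡ᵇ z then y else assign xs ys z
assign _        _        _ = 0

intervalAt : ∀ γ p r → Maybe (HasInterval γ (p ++ r))
intervalAt γ p r
  with r ≟L (map h γ ++ drop n r)
     | All.all? (λ x → All.all? (λ y → (x <? y) →-dec (h x <? h y)) γ) γ
     | All.all? (λ x → All.all? (x <?_) (map h γ) ⊎-dec All.all? (_<? x) (map h γ)) (p ++ drop n r)
  where
  n = length γ
  h = assign γ (take n r)
... | yes e | yes m | yes S =
  just (interval p _ _ (cong (p ++_) e) (λ x∈ y∈ → All.lookup (All.lookup m x∈) y∈) S)
... | _ | _ | _ = nothing

-- A search over all starting positions. On closed words it evaluates, and `from-just` then extracts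
-- the interval.
findInterval : ∀ γ β → Maybe (HasInterval γ β)
findInterval γ β = go (length β)
  where
  at : ∀ n → Maybe (HasInterval γ β)
  at n = subst (Maybe ∘ HasInterval γ) (Listₚ.take++drop≡id n β) (intervalAt γ (take n β) (drop n β))
  go : ℕ → Maybe (HasInterval γ β)
  go zero    = at zero
  go (suc n) = at (suc n) <∣> go n

all-maybe : ∀ {P : Word → Set} → (∀ w → Maybe (P w)) → ∀ ws → Maybe (All P ws)
all-maybe p? []       = just []
all-maybe p? (w ∷ ws) = Maybe.zipWith _∷_ (p? w) (all-maybe p? ws)

Class : Word → Word → Word → Word → Set
Class φ ψ ψ′ β = st β ≼ ψ′ ⊎ HasInterval ψ β ⊎ (∃ λ γ → Kill φ γ × HasInterval γ β)

findKill : ∀ {φ γs} → All (Kill φ) γs → ∀ β → Maybe (∃ λ γ → Kill φ γ × HasInterval γ β)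
findKill []       β = nothing
findKill {γs = γ ∷ _} (K ∷ Ks) β = Maybe.map (λ I → γ , K , I) (findInterval γ β) <∣> findKill Ks β

findClass : ∀ {φ γs} ψ ψ′ → All (Kill φ) γs → ∀ β → Maybe (Class φ ψ ψ′ β)
findClass ψ ψ′ Ks β with st β ≼? ψ′
... | yes i = just (inj₁ i)
... | no _  = Maybe.map (inj₂ ∘ inj₁) (findInterval ψ β) <∣> Maybe.map (inj₂ ∘ inj₂) (findKill Ks β)

all-⊆ : ∀ {P : Word → Set} {ws} → All P (subseqs ws) → ∀ {us} → us ⊆ ws → P us
all-⊆ ps s = All.lookup ps (⊆⇒∈subseqs s)

all-⊆? : ∀ {P : Word → Set} (P? : ∀ w → Dec (P w)) ws {t : True (All.all? P? (subseqs ws))} →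
  ∀ {us} → us ⊆ ws → P us
all-⊆? P? ws {t} = all-⊆ (toWitness t)

-- All proper patterns of 12 are covered by 1, so `φ₁`, `φ₂` and `φ₀` coincide and the weight 12 - 1
-- - 1 + 1 collapses to 12 - 1.
reduction-12-21 : Reduction p12 p21
reduction-12-21 = record
  { φ₁ = 0 ∷ [] ; φ₂ = 0 ∷ [] ; φ₀ = 0 ∷ [] ; ψ′ = 0 ∷ []
  ; φ₁⊆ = refl ∷ 1 ∷ʳ [] ; φ₂⊆ = refl ∷ 1 ∷ʳ [] ; φ₀⊆φ₁ = ⊆-refl ; φ₀⊆φ₂ = ⊆-refl ; ψ′⊆ = 1 ∷ʳ refl ∷ []
  ; φ₁-short = lt ; φ₂-short = lt ; ψ′-short = lt ; φ₀-nonempty = lt ; ψ′-nonempty = lt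
  ; cover = all-⊆? (λ α → α ≟L p12 ⊎-dec st α ≼? (0 ∷ []) ⊎-dec st α ≼? (0 ∷ [])) p12
  ; meet = λ s _ → inj₁ (⊆⇒≼ s)
  ; classify = all-⊆ (from-just (all-maybe (findClass p21 (0 ∷ []) []) (subseqs p21)))
  }

kill-12-21 : Kill p12 p21
kill-12-21 = reduction⇒kill reduction-12-21 (after⇒disjoint after-12-21 after-21-12)

kill-trans : ∀ {α β γ δ} → HasInterval γ α → HasInterval δ β → Kill γ δ → Kill α β
kill-trans I J K w I′ J′ = K w (interval-trans I I′) (interval-trans J J′)

module _ {ψ ψ′ : Word} (ψ′⊆ : ψ′ ⊆ ψ) (ψ′-short : length ψ′ < length ψ) (ψ′-nonempty : 0 < length ψ′)
         (classify : ∀ {β} → β ⊆ ψ → Class p312 ψ ψ′ β) where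

  -- The maximal proper patterns of 312 are 12 and 21, taken here as the subwords `0 ∷ 1 ∷ []` and
  -- `2 ∷ 0 ∷ []`. When neither fits into the single letter, `σ` has intervals 12 and 21, and
  -- `kill-12-21` supplies `meet`.
  reduction-312 : Reduction p312 ψ
  reduction-312 = record
    { φ₁ = 0 ∷ 1 ∷ [] ; φ₂ = 2 ∷ 0 ∷ [] ; φ₀ = 0 ∷ [] ; ψ′ = ψ′
    ; φ₁⊆ = 2 ∷ʳ ⊆-refl ; φ₂⊆ = refl ∷ refl ∷ 1 ∷ʳ [] ; φ₀⊆φ₁ = refl ∷ 1 ∷ʳ [] ; φ₀⊆φ₂ = 2 ∷ʳ ⊆-refl ; ψ′⊆ = ψ′⊆
    ; φ₁-short = lt ; φ₂-short = lt ; ψ′-short = ψ′-short ; φ₀-nonempty = lt ; ψ′-nonempty = ψ′-nonempty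
    ; cover = all-⊆? (λ α → α ≟L p312 ⊎-dec st α ≼? (0 ∷ 1 ∷ []) ⊎-dec st α ≼? (2 ∷ 0 ∷ [])) p312
    ; meet = λ s t → meet (proper s) (proper′ t)
    ; classify = classify
    }
    where
    proper : ∀ {α} → α ⊆ 0 ∷ 1 ∷ [] → st α ≼ (0 ∷ []) ⊎ α ≡ 0 ∷ 1 ∷ []
    proper = all-⊆? (λ α → st α ≼? (0 ∷ []) ⊎-dec α ≟L (0 ∷ 1 ∷ [])) (0 ∷ 1 ∷ [])
    proper′ : ∀ {α} → α ⊆ 2 ∷ 0 ∷ [] → st α ≼ (0 ∷ []) ⊎ α ≡ 2 ∷ 0 ∷ []
    proper′ = all-⊆? (λ α → st α ≼? (0 ∷ []) ⊎-dec α ≟L (2 ∷ 0 ∷ [])) (2 ∷ 0 ∷ [])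
    meet : ∀ {α₁ α₂} → st α₁ ≼ (0 ∷ []) ⊎ α₁ ≡ 0 ∷ 1 ∷ [] → st α₂ ≼ (0 ∷ []) ⊎ α₂ ≡ 2 ∷ 0 ∷ [] →
      st α₁ ≼ (0 ∷ []) ⊎ st α₂ ≼ (0 ∷ []) ⊎ Kill α₁ α₂
    meet (inj₁ i)    _           = inj₁ i
    meet (inj₂ refl) (inj₁ j)    = inj₂ (inj₁ j)
    meet (inj₂ refl) (inj₂ refl) = inj₂ (inj₂ (kill-trans (from-just (findInterval p12 (0 ∷ 1 ∷ [])))
      (from-just (findInterval p21 (2 ∷ 0 ∷ []))) kill-12-21))

kill-312-21 : Kill p312 p21
kill-312-21 = kill-trans (from-just (findInterval p12 p312)) (from-just (findInterval p21 p21)) kill-12-21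

kill-312-123 : Kill p312 p123
kill-312-123 = reduction⇒kill
  (reduction-312 {ψ′ = 0 ∷ 1 ∷ []} (refl ∷ refl ∷ 2 ∷ʳ []) lt lt
    (all-⊆ (from-just (all-maybe (findClass p123 (0 ∷ 1 ∷ []) []) (subseqs p123)))))
  (after⇒disjoint (after-312 lt lt #0) after-123-312)

-- Apart from 2314 itself, the subwords whose pattern is not in 231 have pattern 123 or 213, and 213
-- has the interval 21.
kill-312-2314 : Kill p312 p2314
kill-312-2314 = reduction⇒kill
  (reduction-312 {ψ′ = 1 ∷ 2 ∷ 0 ∷ []} (refl ∷ refl ∷ refl ∷ 3 ∷ʳ []) lt lt
    (all-⊆ (from-just (all-maybe
      (findClass p2314 (1 ∷ 2 ∷ 0 ∷ []) (kill-312-21 ∷ kill-312-123 ∷ [])) (subseqs p2314)))))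
  (after⇒disjoint (after-312 lt lt #1) after-2314-312)

-- Apart from 23514 itself, the patterns of subwords that are not in 2413 are 123, 2314, 1243 and
-- 2341. The last two have the intervals 21 and 123, so the three known pairs suffice.
kill-312-23514 : Kill p312 p23514
kill-312-23514 = reduction⇒kill
  (reduction-312 {ψ′ = 2 ∷ 4 ∷ 0 ∷ 3 ∷ []} (1 ∷ʳ ⊆-refl) lt lt
    (all-⊆ (from-just (all-maybe
      (findClass p23514 (2 ∷ 4 ∷ 0 ∷ 3 ∷ []) (kill-312-21 ∷ kill-312-123 ∷ kill-312-2314 ∷ [])) (subseqs p23514)))))
  (after⇒disjoint (after-312 lt lt #0) after-23514-312)

-- Inflations

sum-filter-mono : ∀ {A : Set} (v size : A → ℕ) {a b} → a ≤ b → ∀ xs →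
  sum (map size (filter (λ x → v x <? a) xs)) ≤ sum (map size (filter (λ x → v x <? b) xs))
sum-filter-mono v size a≤b [] = z≤n
sum-filter-mono v size {a} {b} a≤b (x ∷ xs) with v x <? a
... | yes l rewrite Listₚ.filter-accept (λ x → v x <? a) {xs = xs} l
                  | Listₚ.filter-accept (λ x → v x <? b) {xs = xs} (ℕₚ.<-≤-trans l a≤b) =
  ℕₚ.+-monoʳ-≤ (size x) (sum-filter-mono v size a≤b xs)
... | no ¬l rewrite Listₚ.filter-reject (λ x → v x <? a) {xs = xs} ¬l with v x <? b
... | yes l rewrite Listₚ.filter-accept (λ x → v x <? b) {xs = xs} l =
  ℕₚ.m≤n⇒m≤o+n (size x) (sum-filter-mono v size a≤b xs)
... | no ¬m rewrite Listₚ.filter-reject (λ x → v x <? b) {xs = xs} ¬m = sum-filter-mono v size a≤b xs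

-- The element `x` is counted under the bound `b` but not under `v x`. For offsets this leaves room
-- for the whole block of the lower entry.
sum-filter-gap : ∀ {A : Set} (v size : A → ℕ) {x b} → v x < b → ∀ {xs} → x ∈ xs →
  sum (map size (filter (λ y → v y <? v x) xs)) ℕ.+ size x ≤ sum (map size (filter (λ y → v y <? b) xs))
sum-filter-gap v size {x} {b} l {_ ∷ xs} (here refl)
  rewrite Listₚ.filter-reject (λ y → v y <? v x) {xs = xs} (ℕₚ.n≮n (v x))
        | Listₚ.filter-accept (λ y → v y <? b) {xs = xs} l
        | ℕₚ.+-comm (sum (map size (filter (λ y → v y <? v x) xs))) (size x) =
  ℕₚ.+-monoʳ-≤ (size x) (sum-filter-mono v size (ℕₚ.<⇒≤ l) xs)
sum-filter-gap v size {x} {b} l {z ∷ xs} (there x∈) with v z <? v x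
... | yes m rewrite Listₚ.filter-accept (λ y → v y <? v x) {xs = xs} m
                  | Listₚ.filter-accept (λ y → v y <? b) {xs = xs} (ℕₚ.<-trans m l)
                  | ℕₚ.+-assoc (size z) (sum (map size (filter (λ y → v y <? v x) xs))) (size x) =
  ℕₚ.+-monoʳ-≤ (size z) (sum-filter-gap v size l x∈)
... | no ¬m rewrite Listₚ.filter-reject (λ y → v y <? v x) {xs = xs} ¬m with v z <? b
... | yes m rewrite Listₚ.filter-accept (λ y → v y <? b) {xs = xs} m =
  ℕₚ.m≤n⇒m≤o+n (size z) (sum-filter-gap v size l x∈)
... | no ¬n rewrite Listₚ.filter-reject (λ y → v y <? b) {xs = xs} ¬n = sum-filter-gap v size l x∈

perm-unique : ∀ {τ} → IsPerm τ → Unique τ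
perm-unique {τ} p = Unique-resp-↭ (↭⇒↭ₛ (↭-sym p)) (Uniqueₚ.upTo⁺ (length τ))

lookup-injective : ∀ {xs : Word} → Unique xs → ∀ k l → List.lookup xs k ≡ List.lookup xs l → k ≡ l
lookup-injective (x∉ ∷ u) Fin.zero    Fin.zero    e = refl
lookup-injective (x∉ ∷ u) Fin.zero    (Fin.suc l) e = contradiction e (All.lookup x∉ (∈-lookup l))
lookup-injective (x∉ ∷ u) (Fin.suc k) Fin.zero    e = contradiction (sym e) (All.lookup x∉ (∈-lookup k))
lookup-injective (x∉ ∷ u) (Fin.suc k) (Fin.suc l) e = cong Fin.suc (lookup-injective u k l e)

module _ {τ : Word} (perm : IsPerm τ) (i j : Fin (length τ)) {φ ψ : Word}
         (φ-bounded : All (_< length φ) φ) (ψ-bounded : All (_< length ψ) ψ) where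

  private
    blk : Fin (length τ) → Word
    blk = block τ i j φ ψ

    off : Fin (length τ) → ℕ
    off = offset τ i j φ ψ

    chunk : Fin (length τ) → Word
    chunk k = map (off k ℕ.+_) (blk k)

    block-bounded : ∀ k → All (_< length (blk k)) (blk k)
    block-bounded k with k Fin.≟ i | k Fin.≟ j
    ... | yes _ | _     = φ-bounded
    ... | no _  | yes _ = ψ-bounded
    ... | no _  | no _  = s≤s z≤n ∷ []

    chunk-< : ∀ {k l} → List.lookup τ k < List.lookup τ l → ∀ {x y} → x ∈ chunk k → y ∈ chunk l → x < y
    chunk-< {k} {l} k<l x∈ y∈ with ∈-map⁻ (off k ℕ.+_) x∈ | ∈-map⁻ (off l ℕ.+_) y∈
    ... | b , b∈ , refl | c , _ , refl = begin-strict
      off k ℕ.+ b                <⟨ ℕₚ.+-monoʳ-< (off k) (All.lookup (block-bounded k) b∈) ⟩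
      off k ℕ.+ length (blk k)   ≤⟨ sum-filter-gap (List.lookup τ) (length ∘ blk) k<l (∈-allFin k) ⟩
      off l                      ≤⟨ ℕₚ.m≤m+n (off l) c ⟩
      off l ℕ.+ c                ∎
      where open ℕₚ.≤-Reasoning

  -- Splitting the list of positions at `k` isolates one chunk; every other chunk lies entirely
  -- above or below it, as the entries of `τ` do.
  inflation-interval : ∀ k → HasInterval (block τ i j φ ψ k) (inflate₂ τ i j φ ψ)
  inflation-interval k with ∈-∃++ (∈-allFin k)
  ... | P , S , e = interval (concatMap chunk P) (concatMap chunk S) (off k ℕ.+_)
    (trans (cong (concatMap chunk) e) (Listₚ.concatMap-++ chunk P (k ∷ S)))
    (λ _ _ → ℕₚ.+-monoʳ-< (off k))
    (subst (Separated (chunk k)) (Listₚ.concatMap-++ chunk P S) (All.tabulate separate))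
    where
    others : ∀ {n} {xs : List (Fin n)} (P : List (Fin n)) {k S l} → Unique xs → xs ≡ P ++ k ∷ S → l ∈ P ++ S → l ≢ k
    others [] (k∉ ∷ _) refl l∈ refl = All.lookup k∉ l∈ refl
    others (x ∷ P) (x∉ ∷ _) refl (here refl) refl = All.lookup x∉ (∈-++⁺ʳ P (here refl)) refl
    others (x ∷ P) (_ ∷ u) refl (there l∈) = others P u refl l∈

    separate : ∀ {x} → x ∈ concatMap chunk (P ++ S) → All (x <_) (chunk k) ⊎ All (_< x) (chunk k)
    separate x∈ with find (∈-concatMap⁻ chunk {xs = P ++ S} x∈)
    ... | l , l∈ , x∈l with ℕₚ.<-cmp (List.lookup τ l) (List.lookup τ k)
    ... | tri< l<k _ _ = inj₁ (All.tabulate (chunk-< l<k x∈l))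
    ... | tri> _ _ k<l = inj₂ (All.tabulate λ y∈ → chunk-< k<l y∈ x∈l)
    ... | tri≈ _ q _   = contradiction (lookup-injective (perm-unique perm) l k q)
                           (others P (Uniqueₚ.allFin⁺ (length τ)) e l∈)

block-i : ∀ τ i j φ ψ → block τ i j φ ψ i ≡ φ
block-i τ i j φ ψ with i Fin.≟ i
... | yes _ = refl
... | no ne = contradiction refl ne

block-j : ∀ τ i j φ ψ → i ≢ j → block τ i j φ ψ j ≡ ψ
block-j τ i j φ ψ i≢j with j Fin.≟ i | j Fin.≟ j
... | yes e | _     = contradiction (sym e) i≢j
... | no _  | yes _ = refl
... | no _  | no ne = contradiction refl ne

interval-length : ∀ {φ w} → HasInterval φ w → length φ ≤ length w
interval-length {φ} (interval p s h refl _ _) = subst (_≤ length (p ++ map h φ ++ s)) (Listₚ.length-map h φ)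
  (Subₚ.length-mono-≤ (middle⊆ p (map h φ) s))

theorem6p3 : (τ : List ℕ) → IsPerm τ → (i j : Fin (length τ)) → i ≢ j →
    μ one (inflate₂ τ i j p312 p23514) ≡ + 0
-- The pair yields the zero at `st w`; `f-st` moves it to `w`, whether or not `w` is standardised.
theorem6p3 τ perm i j i≢j = f-st w (ℕₚ.≤-trans lt (interval-length has312)) (kill-312-23514 w has312 has23514)
  where
  w = inflate₂ τ i j p312 p23514
  intervals : ∀ k → HasInterval (block τ i j p312 p23514 k) w
  intervals = inflation-interval perm i j (lt ∷ lt ∷ lt ∷ []) (lt ∷ lt ∷ lt ∷ lt ∷ lt ∷ [])
  has312 : HasInterval p312 w
  has312 = subst (λ φ → HasInterval φ w) (block-i τ i j p312 p23514) (intervals i)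
  has23514 : HasInterval p23514 w
  has23514 = subst (λ φ → HasInterval φ w) (block-j τ i j p312 p23514 i≢j) (intervals j)
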